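{- Let $A$ and $B$ be skew shapes. If $s_A - s_B$ is $F$-positive, then the following three equivalent conditions are true: (1) $\mathrm{rows}_k(A) \preceq \mathrm{rows}_k(B)$ for all $k\ge 1$; (2) $\mathrm{cols}_\ell(A) \preceq \mathrm{cols}_\ell(B)$ for all $\ell\ge 1$; (3) $\mathrm{rects}_{k,\ell}(A) \le \mathrm{rects}_{k,\ell}(B)$ for all $k,\ell\ge 1$.
   Context: A composition of $n$ is a sequence of positive integers with sum $n$; a partition is a weakly decreasing composition. Compositions $\alpha=(\alpha_1,\dots,\alpha_k)$ of $n$ correspond bijectively to subsets of $[n-1]=\{1,\dots,n-1\}$ via $S(\alpha)=\{\alpha_1,\alpha_1+\alpha_2,\dots,\alpha_1+\cdots+\alpha_{k-1}\}$. Young diagrams are left-justified with row $1$ at the top; a skew shape $\lambda/\mu$ is the Young diagram of $\lambda$ with the boxes of $\mu\subseteq\lambda$ removed from its top-left. A standard Young tableau (SYT) of a skew shape $A$ with $n$ boxes is a filling of the boxes by $1,\dots,n$, each used once, increasing left to right along rows and down columns. Its descent set is the set of $i$ such that $i+1$ appears in a strictly lower row than $i$, and its descent composition is the composition of $n$ corresponding to its descent set. The monomial quasisymmetric functions are $M_\alpha=\sum_{i_1<\cdots<i_k}x_{i_1}^{\alpha_1}\cdots x_{i_k}^{\alpha_k}$, and the fundamental quasisymmetric functions are $F_\alpha=\sum_{S(\alpha)\subseteq S(\beta)\subseteq[n-1]}M_\beta$ for $\alpha$ of size $n$; they form a basis of the quasisymmetric functions. The skew Schur function is $s_A=\sum_T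 F_{\mathrm{comp}(T)}$, the sum being over all SYT $T$ of shape $A$, where $\mathrm{comp}(T)$ is the descent composition of $T$. A quasisymmetric function is $F$-positive if all its coefficients in the $F$-basis are nonnegative. For a skew shape $A$ with $r$ rows and $1\le i\le r-k+1$, let $\mathrm{overlap}_k(i)$ be the number of columns occupied in common by rows $i,i+1,\dots,i+k-1$; $\mathrm{rows}_k(A)$ is the partition obtained by sorting $(\mathrm{overlap}_k(1),\dots,\mathrm{overlap}_k(r-k+1))$ into weakly decreasing order and omitting zeros (so it is the empty partition if there are no nonzero overlaps). $\mathrm{cols}_\ell(A)$ is defined in the same way with the roles of rows and columns exchanged. $\mathrm{rects}_{k,\ell}(A)$ is the number of $k\times\ell$ rectangular subdiagrams ($k$ rows, $\ell$ columns, consecutive) contained in $A$. Dominance order, for partitions possibly of different sizes: $\lambda=(\lambda_1,\dots,\lambda_r)\preceq\mu=(\mu_1,\dots,\mu_s)$ if $\lambda_1+\cdots+\lambda_k\le\mu_1+\cdots+\mu_k$ for all $k=1,\dots,r$, where $\mu_i=0$ for $i>s$. -}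

module Defs where

open import Data.Fin.Base as Fin using (Fin; toℕ)
import Data.Fin.Properties as Fin
open import Data.Integer.Base as ℤ using (ℤ; 0ℤ; 1ℤ)
open import Data.List.Base using (List; []; _∷_; _++_; map; filter; foldr; take; length; upTo; allFin; cartesianProduct; cartesianProductWith)
import Data.List.Base as List
import Data.List.Sort
open import Data.List.Properties using (≡-dec)
open import Data.List.Relation.Binary.Subset.DecPropositional using (_⊆?_)
open import Data.List.Relation.Unary.All using (All)
open import Data.List.Relation.Unary.Linked using (Linked)
open import Data.List.Relation.Unary.Unique.Propositional using (Unique)
open import Data.Nat.Base using (ℕ; zero; suc; _+_; _∸_; _≤_; _<_; _≥_)
open import Data.Nat.ListAction using (sum)
open import Data.Nat.Properties using (_≟_; _≤?_; _<?_; allUpTo?; ≤-decTotalOrder)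
open import Data.Product.Base using (Σ; ∃₂; _×_; _,_; proj₁; proj₂)
open import Data.Vec.Base as Vec using (Vec)
open import Data.Bool.Base using (if_then_else_)
open import Function.Base using (flip; _∘_)
open import Relation.Binary.Construct.Flip.EqAndOrd using (decTotalOrder)
open import Relation.Binary.Definitions using () renaming (Decidable to Decidable₂)
open import Relation.Binary.PropositionalEquality.Core using (_≡_; _≗_)
open import Relation.Nullary.Decidable using (does; map′; _×-dec_; _→-dec_)
open import Relation.Unary using (Decidable)

module Descending = Data.List.Sort (decTotalOrder ≤-decTotalOrder)

-- [ n ∸1] is the list 1, …, n-1.
[_∸1] : ℕ → List ℕ
[ n ∸1] = map suc (upTo (n ∸ 1))

IsComposition : List ℕ → Set
IsComposition = All (0 <_)

-- S(α) = {α₁, α₁+α₂, …, α₁+⋯+αₖ₋₁}, in increasing order.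
S : List ℕ → List ℕ
S []              = []
S (_ ∷ [])        = []
S (a ∷ α@(_ ∷ _)) = a ∷ map (a +_) (S α)

gaps : ℕ → List ℕ → List ℕ
gaps _ []       = []
gaps p (d ∷ ds) = (d ∸ p) ∷ gaps d ds

-- The inverse of S: the composition of n corresponding to a subset of
-- [n-1] listed in increasing order (d₁, d₂ - d₁, …, n - dₖ).
fromSet : ℕ → List ℕ → List ℕ
fromSet zero      _  = []
fromSet n@(suc _) ds = gaps 0 (ds ++ n ∷ [])

incrementHead : List ℕ → List ℕ
incrementHead []      = []
incrementHead (a ∷ α) = suc a ∷ α

-- All compositions of n, each once: a composition of n + 2 either starts
-- with 1, or arises from one of n + 1 by incrementing its first part.
compositions : ℕ → List (List ℕ)
compositions zero          = [] ∷ []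
compositions (suc zero)    = (1 ∷ []) ∷ []
compositions (suc (suc n)) =
  map (1 ∷_) (compositions (suc n)) ++ map incrementHead (compositions (suc n))

-- Formal power series over ℤ in x₁, x₂, …: f (e₁ ∷ ⋯ ∷ eₘ ∷ []) is the
-- coefficient of x₁^e₁ ⋯ xₘ^eₘ.  Lists differing only by trailing zeros
-- denote the same monomial; every series below respects this.
PowerSeries : Set
PowerSeries = List ℕ → ℤ

_⊕_ _⊖_ : PowerSeries → PowerSeries → PowerSeries
(f ⊕ g) e = f e ℤ.+ g e
(f ⊖ g) e = f e ℤ.- g e

_·_ : ℤ → PowerSeries → PowerSeries
(c · f) e = c ℤ.* f e

∑ : {I : Set} → List I → (I → PowerSeries) → PowerSeries
∑ is f = foldr (λ i g → f i ⊕ g) (λ _ → 0ℤ) is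

-- For a composition α, x^e equals x_{i₁}^α₁ ⋯ x_{iₖ}^αₖ for some
-- i₁ < ⋯ < iₖ iff the nonzero exponents in e, read in order, form α; the
-- indices i₁, …, iₖ are then unique.
M : List ℕ → PowerSeries
M α e = if does (≡-dec _≟_ (filter (0 <?_) e) α) then 1ℤ else 0ℤ

F : List ℕ → PowerSeries
F α = ∑ (filter (λ β → _⊆?_ _≟_ (S α) (S β)) (compositions (sum α))) M

-- The expansion of f in the basis of fundamental quasisymmetric
-- functions; compositions outside support have coefficient zero.
record FExpansion (f : PowerSeries) : Set where
  field
    support   : List (List ℕ)
    isComp    : All IsComposition support
    unique    : Unique support
    coeff     : List ℕ → ℤ
    expansion : f ≗ ∑ support (λ α → coeff α · F α)

FPositive : PowerSeries → Set
FPositive f = Σ (FExpansion f) λ E →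
  let open FExpansion E in All (λ α → 0ℤ ℤ.≤ coeff α) support

record Partition : Set where
  field
    parts      : List ℕ
    decreasing : Linked _≥_ parts
    positive   : All (0 <_) parts

-- part λ i is λᵢ₊₁, taken to be 0 beyond the last part.
part : List ℕ → ℕ → ℕ
part []      _       = 0
part (x ∷ _) zero    = x
part (_ ∷ l) (suc i) = part l i

record SkewShape : Set where
  field
    outer     : Partition
    inner     : Partition
    contained : ∀ i → part (Partition.parts inner) i ≤ part (Partition.parts outer) i

  outerParts innerParts : List ℕ
  outerParts = Partition.parts outer
  innerParts = Partition.parts inner

  height width : ℕ
  height = length outerParts
  width  = part outerParts 0

-- Rows and columns are numbered from 0, row 0 at the top.
Box : SkewShape → ℕ → ℕ → Set
Box A i j = part innerParts i ≤ j × j < part outerParts i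
  where open SkewShape A

box? : (A : SkewShape) → Decidable₂ (Box A)
box? A i j = (part innerParts i ≤? j) ×-dec (j <? part outerParts i)
  where open SkewShape A

boxes : SkewShape → List (ℕ × ℕ)
boxes A = filter (λ (i , j) → box? A i j) (cartesianProduct (upTo height) (upTo width))
  where open SkewShape A

size : SkewShape → ℕ
size A = length (boxes A)

module _ (A : SkewShape) where

  -- Boxes are addressed by their position in boxes A.
  row col : Fin (size A) → ℕ
  row p = proj₁ (List.lookup (boxes A) p)
  col p = proj₂ (List.lookup (boxes A) p)

  Filling : Set
  Filling = Vec (Fin (size A)) (size A)

  -- Entries are 1, …, n; the vector stores them lowered by one.
  entry : Filling → Fin (size A) → ℕ
  entry T p = suc (toℕ (Vec.lookup T p))

  -- There are as many boxes as values, so each value is used exactly once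
  -- iff no value is used twice.
  record IsSYT (T : Filling) : Set where
    constructor isSYT
    field
      injective    : ∀ p q → entry T p ≡ entry T q → p ≡ q
      rowsIncrease : ∀ p q → row p ≡ row q → col p < col q → entry T p < entry T q
      colsIncrease : ∀ p q → col p ≡ col q → row p < row q → entry T p < entry T q

  isSYT? : Decidable IsSYT
  isSYT? T = map′
    (λ (a , b , c) → isSYT a b c)
    (λ (isSYT a b c) → a , b , c)
    (Fin.all? (λ p → Fin.all? λ q → (entry T p ≟ entry T q) →-dec (p Fin.≟ q))
     ×-dec
     Fin.all? (λ p → Fin.all? λ q →
       (row p ≟ row q) →-dec ((col p <? col q) →-dec (entry T p <? entry T q)))
     ×-dec
     Fin.all? (λ p → Fin.all? λ q →
       (col p ≟ col q) →-dec ((row p <? row q) →-dec (entry T p <? entry T q))))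

  Descent : Filling → ℕ → Set
  Descent T i = ∃₂ λ p q → entry T p ≡ i × entry T q ≡ suc i × row p < row q

  descent? : (T : Filling) → Decidable (Descent T)
  descent? T i = Fin.any? λ p → Fin.any? λ q →
    (entry T p ≟ i) ×-dec (entry T q ≟ suc i) ×-dec (row p <? row q)

  comp : Filling → List ℕ
  comp T = fromSet (size A) (filter (descent? T) [ size A ∸1])

-- All words of length m over Fin n, each once.
words : (n m : ℕ) → List (Vec (Fin n) m)
words n zero    = Vec.[] ∷ []
words n (suc m) = cartesianProductWith Vec._∷_ (allFin n) (words n m)

SYTs : (A : SkewShape) → List (Filling A)
SYTs A = filter (isSYT? A) (words (size A) (size A))

s : SkewShape → PowerSeries
s A = ∑ (SYTs A) (F ∘ comp A)

-- The number of columns j < w occupied in common by rows i, …, i + k - 1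
-- of a diagram R.
overlapOf : {R : ℕ → ℕ → Set} → Decidable₂ R → (w k i : ℕ) → ℕ
overlapOf R? w k i =
  length (filter (λ j → allUpTo? (λ a → R? (i + a) j) k) (upTo w))

-- For a diagram R with h rows and w columns: the overlaps of the
-- h - k + 1 (none if h < k) runs of k consecutive rows, sorted and
-- with zeros omitted.
sortedOverlaps : {R : ℕ → ℕ → Set} → Decidable₂ R → (h w k : ℕ) → List ℕ
sortedOverlaps R? h w k =
  Descending.sort (filter (0 <?_) (map (overlapOf R? w k) (upTo (suc h ∸ k))))

rows : ℕ → SkewShape → List ℕ
rows k A = sortedOverlaps (box? A) height width k
  where open SkewShape A

cols : ℕ → SkewShape → List ℕ
cols ℓ A = sortedOverlaps (flip (box? A)) width height ℓ
  where open SkewShape A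

-- A k × ℓ rectangle is counted by its top left box (i , j), so this is
-- the number of rectangular subdiagrams when k, ℓ ≥ 1.
rects : ℕ → ℕ → SkewShape → ℕ
rects k ℓ A =
  length (filter (λ (i , j) → allUpTo? (λ a → allUpTo? (λ b → box? A (i + a) (j + b)) ℓ) k)
                 (cartesianProduct (upTo height) (upTo width)))
  where open SkewShape A

infix 4 _≼_

-- Partial sums past the end of μ equal the full sum, as if μ were
-- padded with zeros.
_≼_ : List ℕ → List ℕ → Set
l ≼ μ = ∀ k → 1 ≤ k → k ≤ length l → sum (take k l) ≤ sum (take k μ)

{-# OPTIONS --safe #-}
module Submission where

-- Both overlap partitions determine the rectangle numbers: a run of k rows
-- with overlap x contains max (x - ℓ + 1, 0) rectangles of width ℓ, so
-- rects k ℓ is the sum of (x - (ℓ - 1))⁺ over the parts x of rows k, and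
-- likewise for columns.  Comparing these sums for all ℓ is weak majorization,
-- which is the dominance order; hence the three conditions are equivalent.
--
-- For the implication, the coefficient of F_α in s_A counts the SYT of shape
-- A with descent composition α, so F-positivity gives, for every SYT U of
-- shape B, an SYT T of shape A with the same descents.  Let U first fill the
-- top k - 1 boxes of every column in horizontal layers, each without inner
-- descents, and then the rest in vertical layers, all of whose inner steps
-- are descents.  In T a set of entries forming a horizontal layer of U meets
-- each column at most once, and one forming a vertical layer meets each row
-- at most once.  So the bottom right corner of a k × ℓ rectangle of A carries
-- an entry that U places in vertical layer ℓ or later, where it is the
-- bottom right corner of a k × ℓ rectangle of B.

open import Defs
open import Data.Bool.Base using (Bool; true; false; if_then_else_)
import Data.Bool.Properties as Bool
open import Data.Fin.Base as Fin using (Fin; toℕ; fromℕ<; punchOut)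
import Data.Fin.Properties as Fin
open import Data.Integer.Base as ℤ using (ℤ; 0ℤ; 1ℤ)
import Data.Integer.Properties as ℤ
open import Data.Integer.Tactic.RingSolver using (solve-∀)
open import Data.List.Base as List
  using (List; []; _∷_; _++_; _∷ʳ_; map; filter; length; upTo; allFin; take; cartesianProduct)
open import Data.List.Membership.Propositional using (_∈_; _∉_; lose; find)
open import Data.List.Membership.Propositional.Properties
open import Data.List.Properties
  using (≡-dec; ∷-injective; ∷ʳ-injective; filter-all; filter-notAll; filter-++; length-++;
         length-tabulate; upTo-∷ʳ; map-++; map-∘; map-cong)
open import Data.List.Relation.Binary.Permutation.Propositional.Properties using () renaming (map⁺ to ↭-map⁺)
open import Data.List.Relation.Binary.Subset.DecPropositional using (_⊆?_)
open import Data.List.Relation.Binary.Subset.Propositional using (_⊆_)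
open import Data.List.Relation.Unary.All as All using (All; []; _∷_)
import Data.List.Relation.Unary.All.Properties as All
open import Data.List.Relation.Unary.AllPairs using (AllPairs; []; _∷_)
import Data.List.Relation.Unary.AllPairs.Properties as AllPairs
open import Data.List.Relation.Unary.Any using (here; there; any?; index)
open import Data.List.Relation.Unary.Any.Properties using (lookup-index)
open import Data.List.Relation.Unary.Linked.Properties using (Linked⇒AllPairs)
open import Data.List.Relation.Unary.Unique.Propositional using (Unique)
import Data.List.Relation.Unary.Unique.Propositional.Properties as Unique
open import Data.Nat.Base
open import Data.Nat.ListAction using (sum)
open import Data.Nat.ListAction.Properties using (sum-++; sum-↭)
open import Data.Nat.Properties
open import Data.Product.Base using (∃; ∃₂; _×_; _,_; proj₁; proj₂; swap; map₁; map₂)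
open import Data.Sum.Base using (_⊎_; inj₁; inj₂; [_,_]′)
open import Data.Vec.Base as Vec using (Vec; []; _∷_)
import Data.Vec.Properties as Vec
open import Function.Base using (_∘_; id; flip)
open import Function.Bundles using (_⇔_; mk⇔; Equivalence)
open import Function.Construct.Composition using (_⇔-∘_)
open import Function.Construct.Symmetry using (⇔-sym)
open import Relation.Binary.Definitions using () renaming (Decidable to Decidable₂)
open import Relation.Binary.PropositionalEquality
open import Relation.Nullary using (¬_; Dec; yes; no; does; contradiction)
open import Relation.Nullary.Decidable using (dec-true; dec-false)
open import Relation.Unary using (Decidable)

-- The F-basis

-- A word over Bool encodes a composition of its length plus one: letter i
-- says whether i + 1 belongs to the corresponding set S.
decode : ∀ {n} → Vec Bool n → List ℕ
decode []          = 1 ∷ []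
decode (true  ∷ v) = 1 ∷ decode v
decode (false ∷ v) = incrementHead (decode v)

incrementHead-positive : ∀ {α} → IsComposition α → IsComposition (incrementHead α)
incrementHead-positive []      = []
incrementHead-positive (_ ∷ p) = s≤s z≤n ∷ p

decode-comp : ∀ {n} (v : Vec Bool n) → IsComposition (decode v)
decode-comp []          = s≤s z≤n ∷ []
decode-comp (true  ∷ v) = s≤s z≤n ∷ decode-comp v
decode-comp (false ∷ v) = incrementHead-positive (decode-comp v)

decode-∷ : ∀ {n} (v : Vec Bool n) → ∃₂ λ a α → decode v ≡ a ∷ α
decode-∷ []          = _ , _ , refl
decode-∷ (true  ∷ v) = _ , _ , refl
decode-∷ (false ∷ v) with decode v | decode-∷ v
... | _ | _ , _ , refl = _ , _ , refl

decode-sum : ∀ {n} (v : Vec Bool n) → sum (decode v) ≡ suc n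
decode-sum []          = refl
decode-sum (true  ∷ v) = cong suc (decode-sum v)
decode-sum (false ∷ v) with decode v | decode-∷ v | decode-sum v
... | _ | _ , _ , refl | eq = cong suc eq

-- Units are taken off the first part one at a time: a first part above 1 gives the letter `false`,
-- a first part 1 with more parts behind it gives `true`, and a lone 1 ends the word. Only the empty
-- composition has no word.
encode : ∀ α → IsComposition α → α ≡ [] ⊎ ∃₂ λ n (v : Vec Bool n) → decode v ≡ α
encode [] [] = inj₁ refl
encode (suc zero ∷ α) (_ ∷ p) with encode α p
... | inj₁ refl = inj₂ (_ , [] , refl)
... | inj₂ (n , v , refl) = inj₂ (_ , true ∷ v , refl)
encode (suc (suc a) ∷ α) (_ ∷ p) with encode (suc a ∷ α) (s≤s z≤n ∷ p)
... | inj₂ (n , v , eq) = inj₂ (_ , false ∷ v , cong incrementHead eq)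

encodeAt : ∀ {n} α → IsComposition α → sum α ≡ suc n → ∃ λ (v : Vec Bool n) → decode v ≡ α
encodeAt α p eq with encode α p
... | inj₁ refl = contradiction (sym eq) 1+n≢0
... | inj₂ (m , v , refl) with suc-injective (trans (sym (decode-sum v)) eq)
... | refl = v , refl

decode∈compositions : ∀ {n} (v : Vec Bool n) → decode v ∈ compositions (suc n)
decode∈compositions []          = here refl
decode∈compositions (true  ∷ v) = ∈-++⁺ˡ (∈-map⁺ (1 ∷_) (decode∈compositions v))
decode∈compositions {suc n} (false ∷ v) =
  ∈-++⁺ʳ (map (1 ∷_) (compositions (suc n))) (∈-map⁺ incrementHead (decode∈compositions v))

compositions⇒decode : ∀ n {α} → α ∈ compositions (suc n) → ∃ λ (v : Vec Bool n) → decode v ≡ α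
compositions⇒decode zero    (here refl) = [] , refl
compositions⇒decode (suc n) α∈ with ∈-++⁻ (map (1 ∷_) (compositions (suc n))) α∈
... | inj₁ α∈₁ with ∈-map⁻ (1 ∷_) α∈₁
... | _ , β∈ , refl with compositions⇒decode n β∈
... | v , refl = true ∷ v , refl
compositions⇒decode (suc n) α∈ | inj₂ α∈₂ with ∈-map⁻ incrementHead α∈₂
... | _ , β∈ , refl with compositions⇒decode n β∈
... | v , refl = false ∷ v , refl

compositions-sum : ∀ n {α} → α ∈ compositions n → sum α ≡ n
compositions-sum zero    (here refl) = refl
compositions-sum (suc n) α∈ with compositions⇒decode n α∈
... | v , refl = decode-sum v

incrementHead-injective : ∀ {α β} → incrementHead α ≡ incrementHead β → α ≡ β
incrementHead-injective {[]}    {[]}    eq   = refl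
incrementHead-injective {x ∷ α} {y ∷ β} refl = refl

compositions-unique : ∀ n → Unique (compositions n)
compositions-unique zero          = [] ∷ []
compositions-unique (suc zero)    = [] ∷ []
compositions-unique (suc (suc n)) = Unique.++⁺
  (Unique.map⁺ (λ { refl → refl }) (compositions-unique (suc n)))
  (Unique.map⁺ incrementHead-injective (compositions-unique (suc n)))
  disjoint
  where
  disjoint : ∀ {α} → ¬ (α ∈ map (1 ∷_) (compositions (suc n)) ×
                        α ∈ map incrementHead (compositions (suc n)))
  disjoint (∈₁ , ∈₂) with ∈-map⁻ (1 ∷_) ∈₁ | ∈-map⁻ incrementHead ∈₂
  ... | _ , _ , refl | β , β∈ , eq with compositions⇒decode n β∈
  ... | v , refl with decode v | decode-∷ v | decode-comp v
  -- A positive head becomes at least 2 when incremented, so it is never 1.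
  disjoint _ | _ , _ , refl | _ , _ , () | _ | _ | _ , _ , refl | s≤s _ ∷ _

S-positive : ∀ {α} → IsComposition α → All (0 <_) (S α)
S-positive []                = []
S-positive (_ ∷ [])          = []
S-positive (s≤s z≤n ∷ p@(_ ∷ _)) = s≤s z≤n ∷ All.map⁺ (All.map (λ _ → s≤s z≤n) (S-positive p))

map-suc-+ : ∀ a xs → map (suc a +_) xs ≡ map suc (map (a +_) xs)
map-suc-+ a []       = refl
map-suc-+ a (x ∷ xs) = cong (_ ∷_) (map-suc-+ a xs)

S-incrementHead : ∀ α → S (incrementHead α) ≡ map suc (S α)
S-incrementHead []          = refl
S-incrementHead (_ ∷ [])    = refl
S-incrementHead (a ∷ b ∷ α) = cong (suc a ∷_) (map-suc-+ a (S (b ∷ α)))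

S-true : ∀ {n} (v : Vec Bool n) → S (decode (true ∷ v)) ≡ 1 ∷ map suc (S (decode v))
S-true v with decode v | decode-∷ v
... | _ | _ , _ , refl = refl

0∉S-decode : ∀ {n} (v : Vec Bool n) → 0 ∉ S (decode v)
0∉S-decode v 0∈ with All.lookup (S-positive (decode-comp v)) 0∈
... | ()

map-suc-⊆⁻ : ∀ {xs ys} → map suc xs ⊆ map suc ys → xs ⊆ ys
map-suc-⊆⁻ sub x∈ with ∈-map⁻ suc (sub (∈-map⁺ suc x∈))
... | _ , y∈ , refl = y∈

map-suc-⊆⁺ : ∀ {xs ys} → xs ⊆ ys → map suc xs ⊆ map suc ys
map-suc-⊆⁺ sub x∈ with ∈-map⁻ suc x∈
... | _ , y∈ , refl = ∈-map⁺ suc (sub y∈)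

infix 4 _⊑_
-- The order of the Boolean lattice, letter by letter. By `S-⊆⁺` and `S-⊆⁻` it is inclusion of the
-- sets `S`, in a form that follows the recursion of `fcoeff`.
data _⊑_ : ∀ {n} → Vec Bool n → Vec Bool n → Set where
  []    : [] ⊑ []
  false : ∀ {n} b {u v : Vec Bool n} → u ⊑ v → false ∷ u ⊑ b ∷ v
  true  : ∀ {n} {u v : Vec Bool n} → u ⊑ v → true ∷ u ⊑ true ∷ v

S-⊆⁺ : ∀ {n} {u v : Vec Bool n} → u ⊑ v → S (decode u) ⊆ S (decode v)
S-⊆⁺ [] ()
S-⊆⁺ {u = _ ∷ u} {_ ∷ v} (false false p) rewrite S-incrementHead (decode u) | S-incrementHead (decode v) =
  map-suc-⊆⁺ (S-⊆⁺ p)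
S-⊆⁺ {u = _ ∷ u} {_ ∷ v} (false true p) rewrite S-incrementHead (decode u) | S-true v =
  there ∘ map-suc-⊆⁺ (S-⊆⁺ p)
S-⊆⁺ {u = _ ∷ u} {_ ∷ v} (true p) rewrite S-true u | S-true v = λ
  { (here refl) → here refl
  ; (there x∈)  → there (map-suc-⊆⁺ (S-⊆⁺ p) x∈) }

S-⊆⁻ : ∀ {n} (u v : Vec Bool n) → S (decode u) ⊆ S (decode v) → u ⊑ v
S-⊆⁻ [] [] _ = []
S-⊆⁻ (false ∷ u) (false ∷ v) sub rewrite S-incrementHead (decode u) | S-incrementHead (decode v) =
  false false (S-⊆⁻ u v (map-suc-⊆⁻ sub))
S-⊆⁻ (false ∷ u) (true ∷ v) sub rewrite S-incrementHead (decode u) | S-true v =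
  -- The leading 1 of `S (decode (true ∷ v))` is read as `suc 0`, so that `map suc` can be cancelled
  -- on both sides; the spurious 0 is then dropped, as no set `S` contains it.
  false true (S-⊆⁻ u v (λ x∈ → dropHead x∈ (map-suc-⊆⁻ {ys = 0 ∷ S (decode v)} sub x∈)))
  where
  dropHead : ∀ {x} → x ∈ S (decode u) → x ∈ 0 ∷ S (decode v) → x ∈ S (decode v)
  dropHead x∈ (here refl) = contradiction x∈ (0∉S-decode u)
  dropHead _  (there x∈)  = x∈
S-⊆⁻ (true ∷ u) (false ∷ v) sub rewrite S-true u | S-incrementHead (decode v) =
  contradiction (map-suc-⊆⁻ {xs = 0 ∷ S (decode u)} sub (here refl)) (0∉S-decode v)
S-⊆⁻ (true ∷ u) (true ∷ v) sub rewrite S-true u | S-true v =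
  true (S-⊆⁻ u v (λ x∈ → dropHead x∈ (map-suc-⊆⁻ {0 ∷ S (decode u)} {0 ∷ S (decode v)} sub (there x∈))))
  where
  dropHead : ∀ {x} → x ∈ S (decode u) → x ∈ 0 ∷ S (decode v) → x ∈ S (decode v)
  dropHead x∈ (here refl) = contradiction x∈ (0∉S-decode u)
  dropHead _  (there x∈)  = x∈

indicator : {P : Set} → Dec P → ℤ
indicator P? = if does P? then 1ℤ else 0ℤ

indicator-yes : {P : Set} (P? : Dec P) → P → indicator P? ≡ 1ℤ
indicator-yes P? p rewrite dec-true P? p = refl

indicator-no : {P : Set} (P? : Dec P) → ¬ P → indicator P? ≡ 0ℤ
indicator-no P? ¬p rewrite dec-false P? ¬p = refl

-- A composition has no zero exponents to filter out, so `M α e` is the indicator of `e ≡ α` and the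
-- sum counts the occurrences of `e` in `L`.
∑M-∉ : ∀ L {e} → IsComposition e → e ∉ L → ∑ L M e ≡ 0ℤ
∑M-∉ []      p e∉ = refl
∑M-∉ (α ∷ L) {e} p e∉ rewrite filter-all (0 <?_) p =
  cong₂ ℤ._+_ (indicator-no (≡-dec _≟_ e α) (λ { refl → e∉ (here refl) })) (∑M-∉ L p (e∉ ∘ there))

∑M-∈ : ∀ {L e} → Unique L → IsComposition e → e ∈ L → ∑ L M e ≡ 1ℤ
∑M-∈ {α ∷ L} {e} (α∉ ∷ _) p (here refl) with r ← ∑M-∉ L p (λ e∈ → All.lookup α∉ e∈ refl)
  rewrite filter-all (0 <?_) p =
  cong₂ ℤ._+_ (indicator-yes (≡-dec _≟_ e α) refl) r
∑M-∈ {α ∷ L} {e} (α∉ ∷ u) p (there e∈) with r ← ∑M-∈ u p e∈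
  rewrite filter-all (0 <?_) p =
  cong₂ ℤ._+_ (indicator-no (≡-dec _≟_ e α) (λ { refl → All.lookup α∉ e∈ refl })) r

F-⊑ : ∀ {n} (u v : Vec Bool n) → u ⊑ v → F (decode u) (decode v) ≡ 1ℤ
F-⊑ {n} u v u⊑v rewrite decode-sum u =
  ∑M-∈ (Unique.filter⁺ P? (compositions-unique (suc n))) (decode-comp v)
       (∈-filter⁺ P? (decode∈compositions v) (S-⊆⁺ u⊑v))
  where P? = λ β → _⊆?_ _≟_ (S (decode u)) (S β)

F-⋢ : ∀ {n} (u v : Vec Bool n) → ¬ u ⊑ v → F (decode u) (decode v) ≡ 0ℤ
F-⋢ {n} u v u⋢v =
  ∑M-∉ (filter P? (compositions (sum (decode u)))) (decode-comp v)
       (λ v∈ → u⋢v (S-⊆⁻ u v (proj₂ (∈-filter⁻ P? {xs = compositions (sum (decode u))} v∈))))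
  where P? = λ β → _⊆?_ _≟_ (S (decode u)) (S β)

F-sum≢ : ∀ β {e} → IsComposition e → sum e ≢ sum β → F β e ≡ 0ℤ
F-sum≢ β p ≢ = ∑M-∉ (filter P? (compositions (sum β))) p
  (λ e∈ → ≢ (compositions-sum (sum β) (proj₁ (∈-filter⁻ P? {xs = compositions (sum β)} e∈))))
  where P? = λ γ → _⊆?_ _≟_ (S β) (S γ)

-- Möbius inversion over the Boolean lattice extracts the coefficient of
-- F (decode v) from the coefficients of the monomials coarser than decode v.
fcoeff : ∀ {n} → Vec Bool n → PowerSeries → ℤ
fcoeff []          f = f (1 ∷ [])
fcoeff (false ∷ v) f = fcoeff v (f ∘ incrementHead)
fcoeff (true  ∷ v) f = fcoeff v (f ∘ (1 ∷_)) ℤ.- fcoeff v (f ∘ incrementHead)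

fcoeff-zero : ∀ {n} (v : Vec Bool n) f → (∀ w → f (decode {n} w) ≡ 0ℤ) → fcoeff v f ≡ 0ℤ
fcoeff-zero []          f h = h []
fcoeff-zero (false ∷ v) f h = fcoeff-zero v _ (h ∘ (false ∷_))
fcoeff-zero (true  ∷ v) f h =
  cong₂ ℤ._-_ (fcoeff-zero v _ (h ∘ (true ∷_))) (fcoeff-zero v _ (h ∘ (false ∷_)))

Upset : ∀ {n} → Vec Bool n → PowerSeries → Set
Upset u f = (∀ w → u ⊑ w → f (decode w) ≡ 1ℤ) × (∀ w → ¬ u ⊑ w → f (decode w) ≡ 0ℤ)

-- Möbius inversion turns the indicator of a principal up-set into the indicator of its generator.
-- If `u` starts with `true`, words starting with `false` contribute nothing; if it starts with
-- `false`, both choices of the first letter leave the up-set of the tail.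
fcoeff-upset : ∀ {n} (u v : Vec Bool n) f → Upset u f →
               (u ≡ v → fcoeff v f ≡ 1ℤ) × (u ≢ v → fcoeff v f ≡ 0ℤ)
fcoeff-upset [] [] f (one , _) = (λ _ → one [] []) , (λ ≢ → contradiction refl ≢)
fcoeff-upset (true ∷ u) (false ∷ v) f (_ , nil) =
  (λ ()) , (λ _ → fcoeff-zero v _ (λ w → nil (false ∷ w) (λ ())))
fcoeff-upset (true ∷ u) (true ∷ v) f (one , nil)
  rewrite fcoeff-zero v (f ∘ incrementHead) (λ w → nil (false ∷ w) (λ ()))
        | ℤ.+-identityʳ (fcoeff v (f ∘ (1 ∷_)))
  with eq , neq ← fcoeff-upset u v (f ∘ (1 ∷_))
         ((λ w p → one (true ∷ w) (true p)) , (λ w ¬p → nil (true ∷ w) (λ { (true p) → ¬p p }))) =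
  (λ { refl → eq refl }) , (λ ≢ → neq (≢ ∘ cong (true ∷_)))
fcoeff-upset (false ∷ u) (false ∷ v) f (one , nil)
  with eq , neq ← fcoeff-upset u v (f ∘ incrementHead)
         ((λ w p → one (false ∷ w) (false false p)) , (λ w ¬p → nil (false ∷ w) (λ { (false _ p) → ¬p p }))) =
  (λ { refl → eq refl }) , (λ ≢ → neq (≢ ∘ cong (false ∷_)))
fcoeff-upset (false ∷ u) (true ∷ v) f (one , nil)
  with eq , neq ← fcoeff-upset u v (f ∘ incrementHead)
         ((λ w p → one (false ∷ w) (false false p)) , (λ w ¬p → nil (false ∷ w) (λ { (false _ p) → ¬p p })))
  with eq′ , neq′ ← fcoeff-upset u v (f ∘ (1 ∷_))
         ((λ w p → one (true ∷ w) (false true p)) , (λ w ¬p → nil (true ∷ w) (λ { (false _ p) → ¬p p })))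
  with Vec.≡-dec Bool._≟_ u v
-- The two terms of the difference are inversions of the same up-set, so they cancel, as 1 - 1 or as
-- 0 - 0.
... | yes u≡v = (λ ()) , (λ _ → cong₂ ℤ._-_ (eq′ u≡v) (eq u≡v))
... | no  u≢v = (λ ()) , (λ _ → cong₂ ℤ._-_ (neq′ u≢v) (neq u≢v))

-- A linear functional dual to `F α`. It is kept abstract because the empty composition has no word
-- and needs a functional other than `fcoeff`.
record CoefficientOf (α : List ℕ) : Set where
  field
    φ        : PowerSeries → ℤ
    φ-cong   : ∀ {f g} → f ≗ g → φ f ≡ φ g
    φ-zero   : φ (λ _ → 0ℤ) ≡ 0ℤ
    φ-⊕      : ∀ f g → φ (f ⊕ g) ≡ φ f ℤ.+ φ g
    φ-·      : ∀ c f → φ (c · f) ≡ c ℤ.* φ f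
    φ-F      : φ (F α) ≡ 1ℤ
    φ-F≢     : ∀ {β} → IsComposition β → β ≢ α → φ (F β) ≡ 0ℤ

fcoeff-cong : ∀ {n} (v : Vec Bool n) {f g} → f ≗ g → fcoeff v f ≡ fcoeff v g
fcoeff-cong []          h = h _
fcoeff-cong (false ∷ v) h = fcoeff-cong v (λ _ → h _)
fcoeff-cong (true  ∷ v) h = cong₂ ℤ._-_ (fcoeff-cong v (λ _ → h _)) (fcoeff-cong v (λ _ → h _))

-‿interchange : ∀ a b c d → (a ℤ.+ b) ℤ.- (c ℤ.+ d) ≡ (a ℤ.- c) ℤ.+ (b ℤ.- d)
-‿interchange = solve-∀

fcoeff-⊕ : ∀ {n} (v : Vec Bool n) f g → fcoeff v (f ⊕ g) ≡ fcoeff v f ℤ.+ fcoeff v g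
fcoeff-⊕ []          f g = refl
fcoeff-⊕ (false ∷ v) f g = fcoeff-⊕ v _ _
fcoeff-⊕ (true  ∷ v) f g =
  trans (cong₂ ℤ._-_ (fcoeff-⊕ v (f ∘ (1 ∷_)) (g ∘ (1 ∷_))) (fcoeff-⊕ v (f ∘ incrementHead) (g ∘ incrementHead)))
        (-‿interchange (fcoeff v (f ∘ (1 ∷_))) _ _ _)

*-distribˡ-minus : ∀ c a b → c ℤ.* a ℤ.- c ℤ.* b ≡ c ℤ.* (a ℤ.- b)
*-distribˡ-minus = solve-∀

fcoeff-· : ∀ {n} (v : Vec Bool n) c f → fcoeff v (c · f) ≡ c ℤ.* fcoeff v f
fcoeff-· []          c f = refl
fcoeff-· (false ∷ v) c f = fcoeff-· v c _
fcoeff-· (true  ∷ v) c f =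
  trans (cong₂ ℤ._-_ (fcoeff-· v c (f ∘ (1 ∷_))) (fcoeff-· v c (f ∘ incrementHead)))
        (*-distribˡ-minus c (fcoeff v (f ∘ (1 ∷_))) _)

F-upset : ∀ {n} (u : Vec Bool n) → Upset u (F (decode u))
F-upset u = F-⊑ u , F-⋢ u

coefficientOf : ∀ {α} → IsComposition α → CoefficientOf α
coefficientOf {α} p with encode α p
... | inj₁ refl = record
  { φ      = λ f → f []
  ; φ-cong = λ h → h []
  ; φ-zero = refl
  ; φ-⊕    = λ _ _ → refl
  ; φ-·    = λ _ _ → refl
  ; φ-F    = refl
  ; φ-F≢   = λ
    { []             β≢ → contradiction refl β≢
    ; {suc b ∷ β} (_ ∷ _) β≢ → F-sum≢ (suc b ∷ β) [] (λ ()) }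
  }
... | inj₂ (n , v , refl) = record
  { φ      = fcoeff v
  ; φ-cong = fcoeff-cong v
  ; φ-zero = fcoeff-zero v _ (λ _ → refl)
  ; φ-⊕    = fcoeff-⊕ v
  ; φ-·    = fcoeff-· v
  ; φ-F    = proj₁ (fcoeff-upset v v _ (F-upset v)) refl
  ; φ-F≢   = F≢
  }
  where
  F≢ : ∀ {β} → IsComposition β → β ≢ decode v → fcoeff v (F β) ≡ 0ℤ
  F≢ {β} q β≢ with sum β ≟ suc n
  -- `F β` is homogeneous of degree `sum β`, so it vanishes at all compositions of `suc n`.
  ... | no  sum≢ = fcoeff-zero v _ (λ w → F-sum≢ β (decode-comp w) (λ eq → sum≢ (trans (sym eq) (decode-sum w))))
  ... | yes sum≡ with encodeAt β q sum≡
  ... | u , refl = proj₂ (fcoeff-upset u v _ (F-upset u)) (β≢ ∘ cong decode)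

module _ {α} (C : CoefficientOf α) where
  open CoefficientOf C

  φ-F-nonneg : ∀ {β} → IsComposition β → 0ℤ ℤ.≤ φ (F β)
  φ-F-nonneg {β} p with ≡-dec _≟_ β α
  ... | yes refl = subst (0ℤ ℤ.≤_) (sym φ-F) (ℤ.+≤+ z≤n)
  ... | no  β≢α  = ℤ.≤-reflexive (sym (φ-F≢ p β≢α))

  φ-∑-nonneg : {I : Set} (is : List I) (f : I → PowerSeries) →
               (∀ {i} → i ∈ is → 0ℤ ℤ.≤ φ (f i)) → 0ℤ ℤ.≤ φ (∑ is f)
  φ-∑-nonneg []       f h = ℤ.≤-reflexive (sym φ-zero)
  φ-∑-nonneg (i ∷ is) f h = subst (0ℤ ℤ.≤_) (sym (φ-⊕ (f i) (∑ is f)))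
    (ℤ.+-mono-≤ (h (here refl)) (φ-∑-nonneg is f (h ∘ there)))

  φ-∑-positive : {I : Set} (is : List I) (f : I → PowerSeries) →
                 (∀ {i} → i ∈ is → 0ℤ ℤ.≤ φ (f i)) →
                 ∀ {i} → i ∈ is → φ (f i) ≡ 1ℤ → 1ℤ ℤ.≤ φ (∑ is f)
  φ-∑-positive (i ∷ is) f h (here refl) eq = subst (1ℤ ℤ.≤_) (sym (φ-⊕ (f i) (∑ is f)))
    (ℤ.+-mono-≤ (ℤ.≤-reflexive (sym eq)) (φ-∑-nonneg is f (h ∘ there)))
  φ-∑-positive (j ∷ is) f h (there i∈)  eq = subst (1ℤ ℤ.≤_) (sym (φ-⊕ (f j) (∑ is f)))
    (ℤ.+-mono-≤ (h (here refl)) (φ-∑-positive is f (h ∘ there) i∈ eq))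

  φ-∑-zero : {I : Set} (is : List I) (f : I → PowerSeries) →
             (∀ {i} → i ∈ is → φ (f i) ≡ 0ℤ) → φ (∑ is f) ≡ 0ℤ
  φ-∑-zero []       f h = φ-zero
  φ-∑-zero (i ∷ is) f h = trans (φ-⊕ (f i) (∑ is f))
    (cong₂ ℤ._+_ (h (here refl)) (φ-∑-zero is f (h ∘ there)))

-- Descent compositions

gaps-positive : ∀ p {ds} → AllPairs _<_ (p ∷ ds) → All (0 <_) (gaps p ds)
gaps-positive p {[]}     _                = []
gaps-positive p {d ∷ ds} ((p<d ∷ _) ∷ ds<) = m<n⇒0<n∸m p<d ∷ gaps-positive d ds<

gaps-injective : ∀ p {ds ds′} → AllPairs _<_ (p ∷ ds) → AllPairs _<_ (p ∷ ds′) →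
                 gaps p ds ≡ gaps p ds′ → ds ≡ ds′
gaps-injective p {[]}     {[]}       _ _ _ = refl
gaps-injective p {d ∷ ds} {d′ ∷ ds′} ((p<d ∷ _) ∷ ds<) ((p<d′ ∷ _) ∷ ds<′) eq with ∷-injective eq
-- Both lists increase from `p`, so the truncated subtractions are exact and can be cancelled.
... | d≡ , rest with ∸-cancelʳ-≡ (<⇒≤ p<d) (<⇒≤ p<d′) d≡
... | refl = cong (d ∷_) (gaps-injective d ds< ds<′ rest)

-- ds lists a subset of {1, …, n - 1} in increasing order.
InSubset : ℕ → List ℕ → Set
InSubset zero      ds = ds ≡ []
InSubset n@(suc _) ds = AllPairs _<_ (0 ∷ ds ++ n ∷ [])

inSubset-filter : ∀ {P : ℕ → Set} (P? : Decidable P) n → InSubset n (filter P? [ n ∸1])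
inSubset-filter P? zero    = refl
inSubset-filter P? (suc n) =
  All.++⁺ (All.filter⁺ P? (All.map⁺ (All.universal (λ _ → z<s) (upTo n)))) (z<s ∷ []) ∷
  AllPairs.++⁺
    (AllPairs.filter⁺ P? (AllPairs.map⁺ (AllPairs.applyUpTo⁺₁ id n (λ i<j _ → s<s i<j))))
    ([] ∷ [])
    (All.filter⁺ P? (All.map⁺ (All.applyUpTo⁺₁ id n (λ i<n → s<s i<n ∷ []))))

fromSet-composition : ∀ n {ds} → InSubset n ds → IsComposition (fromSet n ds)
fromSet-composition zero    _   = []
fromSet-composition (suc n) ds< = gaps-positive 0 ds<

words-complete : ∀ {n m} (T : Vec (Fin n) m) → T ∈ words n m
words-complete []      = here refl
words-complete (x ∷ T) = ∈-cartesianProductWith⁺ Vec._∷_ (∈-allFin x) (words-complete T)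

module _ (A : SkewShape) where

  ∈SYTs⁺ : ∀ {T} → IsSYT A T → T ∈ SYTs A
  ∈SYTs⁺ {T} syt = ∈-filter⁺ (isSYT? A) (words-complete T) syt

  ∈SYTs⁻ : ∀ {T} → T ∈ SYTs A → IsSYT A T
  ∈SYTs⁻ T∈ = proj₂ (∈-filter⁻ (isSYT? A) {xs = words (size A) (size A)} T∈)

  descents : Filling A → List ℕ
  descents T = filter (descent? A T) [ size A ∸1]

  descents-inSubset : ∀ T → InSubset (size A) (descents T)
  descents-inSubset T = inSubset-filter (descent? A T) (size A)

  comp-composition : ∀ T → IsComposition (comp A T)
  comp-composition T = fromSet-composition (size A) (descents-inSubset T)

  ∈descents⁺ : ∀ T {i} → Descent A T i → i ∈ descents T
  ∈descents⁺ T d@(p , q , refl , eq , _) = ∈-filter⁺ (descent? A T)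
    (∈-map⁺ suc (∈-upTo⁺ (pred-< (subst (_≤ size A) eq (Fin.toℕ<n (Vec.lookup T q)))))) d
    where
    pred-< : ∀ {i n} → suc (suc i) ≤ n → i < n ∸ 1
    pred-< (s≤s le) = le

  ∈descents⁻ : ∀ T {i} → i ∈ descents T → Descent A T i
  ∈descents⁻ T i∈ = proj₂ (∈-filter⁻ (descent? A T) {xs = [ size A ∸1]} i∈)

-- `fromSet` appends the size to the set before taking gaps, so undoing the gaps recovers the size
-- as the last element. This is how equal descent compositions force shapes to have equal size.
fromSet-injective : ∀ m n {ds es} → InSubset m ds → InSubset n es →
                    fromSet m ds ≡ fromSet n es → m ≡ n × ds ≡ es
fromSet-injective zero    zero    refl refl _ = refl , refl
fromSet-injective zero    (suc n) {es = []}    _ _ ()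
fromSet-injective zero    (suc n) {es = _ ∷ _} _ _ ()
fromSet-injective (suc m) zero    {[]}    _ _ ()
fromSet-injective (suc m) zero    {_ ∷ _} _ _ ()
fromSet-injective (suc m) (suc n) ds< es< eq
  with ds≡ , m≡n ← ∷ʳ-injective _ _ (gaps-injective 0 ds< es< eq) = m≡n , ds≡

module _ (A B : SkewShape) (T : Filling A) (U : Filling B) (eq : comp A T ≡ comp B U) where

  private
    same : size A ≡ size B × descents A T ≡ descents B U
    same = fromSet-injective (size A) (size B) (descents-inSubset A T) (descents-inSubset B U) eq

  comp≡⇒size : size A ≡ size B
  comp≡⇒size = proj₁ same

  comp≡⇒descent : ∀ {i} → Descent A T i → Descent B U i
  comp≡⇒descent {i} d = ∈descents⁻ B U (subst (i ∈_) (proj₂ same) (∈descents⁺ A T d))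

-- From F-positivity to tableaux with equal descents

≡-minus⇒ : ∀ {a b c} → a ℤ.- b ≡ c → a ≡ b ℤ.+ c
≡-minus⇒ {a} {b} refl = lemma a b
  where
  lemma : ∀ a b → a ≡ b ℤ.+ (a ℤ.- b)
  lemma = solve-∀

-- Apply the coefficient functional of `F (g j)` after moving the sum over `js` to the other side.
-- That sum contributes at least 1 and the F-positive difference at least 0, whereas the sum over
-- `is` would give 0 if no `f i` were equal to `g j`.
FPositive⇒∈ : {I J : Set} (is : List I) (js : List J) {f : I → List ℕ} {g : J → List ℕ} →
              (∀ i → IsComposition (f i)) → (∀ j → IsComposition (g j)) →
              FPositive (∑ is (F ∘ f) ⊖ ∑ js (F ∘ g)) →
              ∀ {j} → j ∈ js → ∃ λ i → i ∈ is × f i ≡ g j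
FPositive⇒∈ is js {f} {g} f-comp g-comp (E , coeff≥0) {j} j∈
  with any? (λ i → ≡-dec _≟_ (f i) (g j)) is
... | yes found = find found
... | no ¬found = contradiction (subst (1ℤ ℤ.≤_) φis≡0 1≤φis) λ { (ℤ.+≤+ ()) }
  where
  open FExpansion E
  C : CoefficientOf (g j)
  C = coefficientOf (g-comp j)
  open CoefficientOf C

  terms : PowerSeries
  terms = ∑ support (λ α → coeff α · F α)

  φis≡ : φ (∑ is (F ∘ f)) ≡ φ (∑ js (F ∘ g)) ℤ.+ φ terms
  φis≡ = trans (φ-cong (λ e → ≡-minus⇒ {∑ is (F ∘ f) e} (expansion e))) (φ-⊕ (∑ js (F ∘ g)) terms)

  φis≡0 : φ (∑ is (F ∘ f)) ≡ 0ℤ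
  φis≡0 = φ-∑-zero C is (F ∘ f) (λ {i} i∈ → φ-F≢ (f-comp i) (λ eq → ¬found (lose i∈ eq)))

  1≤φjs : 1ℤ ℤ.≤ φ (∑ js (F ∘ g))
  1≤φjs = φ-∑-positive C js (F ∘ g) (λ {j} _ → φ-F-nonneg C (g-comp j)) j∈ φ-F

  0≤φterms : 0ℤ ℤ.≤ φ terms
  0≤φterms = φ-∑-nonneg C support (λ α → coeff α · F α) λ {α} α∈ →
    subst (0ℤ ℤ.≤_) (sym (φ-· (coeff α) (F α)))
      (subst (ℤ._≤ coeff α ℤ.* φ (F α)) (ℤ.*-zeroʳ (coeff α))
        (ℤ.*-monoˡ-≤-nonNeg (coeff α) {{ℤ.nonNegative (All.lookup coeff≥0 α∈)}}
          (φ-F-nonneg C (All.lookup isComp α∈))))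

  1≤φis : 1ℤ ℤ.≤ φ (∑ is (F ∘ f))
  1≤φis = subst (1ℤ ℤ.≤_) (sym φis≡) (ℤ.+-mono-≤ 1≤φjs 0≤φterms)

FPositive⇒support : ∀ A B → FPositive (s A ⊖ s B) →
                    ∀ U → IsSYT B U → ∃ λ T → IsSYT A T × comp A T ≡ comp B U
FPositive⇒support A B pos U sytU =
  map₂ (λ {T} → map₁ (∈SYTs⁻ A {T}))
    (FPositive⇒∈ (SYTs A) (SYTs B) {comp A} {comp B} (comp-composition A) (comp-composition B)
                 pos (∈SYTs⁺ B {U} sytU))

-- Weak majorization

excess : ℕ → List ℕ → ℕ
excess t l = sum (map (_∸ t) l)

excess-≤ : ∀ {t} {l : List ℕ} → All (_≤ t) l → excess t l ≡ 0
excess-≤ []          = refl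
excess-≤ (x≤t ∷ l≤t) = cong₂ _+_ (m≤n⇒m∸n≡0 x≤t) (excess-≤ l≤t)

+-∸-regroup : ∀ {t x} e m → t ≤ x → ((x ∸ t) + e) + (t + m) ≡ x + (e + m)
+-∸-regroup {t} {x} e m t≤x = begin
  ((x ∸ t) + e) + (t + m)   ≡⟨ +-assoc (x ∸ t) e (t + m) ⟩
  (x ∸ t) + (e + (t + m))   ≡⟨ cong ((x ∸ t) +_) (+-assoc e t m) ⟨
  (x ∸ t) + ((e + t) + m)   ≡⟨ cong (λ y → (x ∸ t) + (y + m)) (+-comm e t) ⟩
  (x ∸ t) + ((t + e) + m)   ≡⟨ cong ((x ∸ t) +_) (+-assoc t e m) ⟩
  (x ∸ t) + (t + (e + m))   ≡⟨ +-assoc (x ∸ t) t (e + m) ⟨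
  ((x ∸ t) + t) + (e + m)   ≡⟨ cong (_+ (e + m)) (m∸n+n≡m t≤x) ⟩
  x + (e + m)               ∎
  where open ≡-Reasoning

-- Each part is at most `t` plus its own excess. Together with `excess-attained` this makes
-- `excess t l` the maximum over `m` of `sum (take m l)` minus `m * t`, a discrete Legendre
-- transform.
take-≤-excess : ∀ t m l → sum (take m l) ≤ excess t l + m * t
take-≤-excess t zero    l       = z≤n
take-≤-excess t (suc m) []      = z≤n
take-≤-excess t (suc m) (x ∷ l) = begin
  x + sum (take m l)                   ≤⟨ +-mono-≤ (m≤n+m∸n x t) (take-≤-excess t m l) ⟩
  (t + (x ∸ t)) + (excess t l + m * t) ≡⟨ cong (_+ (excess t l + m * t)) (+-comm t (x ∸ t)) ⟩
  ((x ∸ t) + t) + (excess t l + m * t) ≡⟨ +-assoc (x ∸ t) t _ ⟩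
  (x ∸ t) + (t + (excess t l + m * t)) ≡⟨ cong ((x ∸ t) +_) (+-assoc t (excess t l) (m * t)) ⟨
  (x ∸ t) + ((t + excess t l) + m * t) ≡⟨ cong (λ y → (x ∸ t) + (y + m * t)) (+-comm t (excess t l)) ⟩
  (x ∸ t) + ((excess t l + t) + m * t) ≡⟨ cong ((x ∸ t) +_) (+-assoc (excess t l) t (m * t)) ⟩
  (x ∸ t) + (excess t l + (t + m * t)) ≡⟨ +-assoc (x ∸ t) (excess t l) _ ⟨
  ((x ∸ t) + excess t l) + (t + m * t) ∎
  where open ≤-Reasoning

-- Here `m` is the number of parts that are at least `t`; the later parts have no excess.
excess-attained : ∀ t {l} → AllPairs _≥_ l →
                  ∃ λ m → m ≤ length l × excess t l + m * t ≡ sum (take m l)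
excess-attained t {[]}    _          = 0 , z≤n , refl
excess-attained t {x ∷ l} (x≥ ∷ l≥) with t ≤? x
... | yes t≤x with m , m≤ , eq ← excess-attained t l≥ =
  suc m , s≤s m≤ , trans (+-∸-regroup (excess t l) (m * t) t≤x) (cong (x +_) eq)
... | no t≰x = 0 , z≤n , trans (+-identityʳ _)
  (excess-≤ {t} (x≤t ∷ All.map (λ y≤x → ≤-trans y≤x x≤t) x≥))
  where x≤t = <⇒≤ (≰⇒> t≰x)

part-≤ : ∀ {x l} → All (_≤ x) l → ∀ k → part l k ≤ x
part-≤ []         k       = z≤n
part-≤ (y≤x ∷ _)  zero    = y≤x
part-≤ (_ ∷ l≤x)  (suc k) = part-≤ l≤x k

-- The dual choice: with `k` fixed, the threshold `part l k` separates the first `suc k` parts from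
-- the rest. Past the end it is 0, and both sides are the full sum.
take-part-excess : ∀ {l} → AllPairs _≥_ l → ∀ k →
                   excess (part l k) l + suc k * part l k ≡ sum (take (suc k) l)
take-part-excess {[]}    _         k       = *-zeroʳ (suc k)
take-part-excess {x ∷ l} (x≥ ∷ l≥) zero    rewrite n∸n≡0 x | excess-≤ x≥ = refl
take-part-excess {x ∷ l} (x≥ ∷ l≥) (suc k) =
  trans (+-∸-regroup (excess t l) (suc k * t) (part-≤ x≥ k)) (cong (x +_) (take-part-excess l≥ k))
  where t = part l k

-- With the number of parts that is optimal for `l`, its excess becomes a partial sum; for `m` the
-- general bound is enough. The optimal number is at most `length l`, so `≼` applies to it.
≼⇒excess-≤ : ∀ {l m} → AllPairs _≥_ l → l ≼ m → ∀ t → excess t l ≤ excess t m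
≼⇒excess-≤ {l} {m} l≥ l≼m t with k , k≤ , eq ← excess-attained t l≥ =
  +-cancelʳ-≤ (k * t) _ _ (begin
    excess t l + k * t  ≡⟨ eq ⟩
    sum (take k l)      ≤⟨ sums k k≤ ⟩
    sum (take k m)      ≤⟨ take-≤-excess t k m ⟩
    excess t m + k * t  ∎)
  where
  open ≤-Reasoning
  sums : ∀ k → k ≤ length l → sum (take k l) ≤ sum (take k m)
  sums zero    _  = z≤n
  sums (suc k) k≤ = l≼m (suc k) (s≤s z≤n) k≤

-- Conversely, the threshold is the one that is optimal for `m`, where the bound by the excess is an
-- equality.
excess-≤⇒≼ : ∀ {l m} → AllPairs _≥_ m → (∀ t → excess t l ≤ excess t m) → l ≼ m
excess-≤⇒≼ {l} {m} m≥ h (suc k) _ _ = begin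
  sum (take (suc k) l)      ≤⟨ take-≤-excess t (suc k) l ⟩
  excess t l + suc k * t    ≤⟨ +-monoˡ-≤ (suc k * t) (h t) ⟩
  excess t m + suc k * t    ≡⟨ take-part-excess m≥ k ⟩
  sum (take (suc k) m)      ∎
  where
  open ≤-Reasoning
  t = part m k

-- Counting in finite lists

lookup-injective : {X : Set} {xs : List X} → Unique xs → ∀ i j →
                   List.lookup xs i ≡ List.lookup xs j → i ≡ j
lookup-injective (_ ∷ _)   Fin.zero    Fin.zero    _  = refl
lookup-injective (x∉ ∷ _)  Fin.zero    (Fin.suc j) eq = contradiction eq (All.lookup x∉ (∈-lookup j))
lookup-injective (x∉ ∷ _)  (Fin.suc i) Fin.zero    eq = contradiction (sym eq) (All.lookup x∉ (∈-lookup i))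
lookup-injective (_ ∷ xs!) (Fin.suc i) (Fin.suc j) eq = cong Fin.suc (lookup-injective xs! i j eq)

-- Choosing for each position in `xs` the position in `ys` of a related element gives an injection
-- between finite index sets.
length-≤-via : {X Y : Set} {xs : List X} {ys : List Y} (_~_ : X → Y → Set) → Unique xs →
               (∀ {x} → x ∈ xs → ∃ λ y → y ∈ ys × x ~ y) →
               (∀ {x x′ y} → x ~ y → x′ ~ y → x ≡ x′) → length xs ≤ length ys
length-≤-via {xs = xs} {ys} _~_ xs! total injective = Fin.injective⇒≤ {f = f} f-injective
  where
  image : ∀ i → ∃ λ y → y ∈ ys × List.lookup xs i ~ y
  image i = total (∈-lookup i)

  f = λ i → index (proj₁ (proj₂ (image i)))

  f~ : ∀ i → List.lookup xs i ~ List.lookup ys (f i)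
  f~ i = subst (List.lookup xs i ~_) (lookup-index (proj₁ (proj₂ (image i)))) (proj₂ (proj₂ (image i)))

  f-injective : ∀ {i j} → f i ≡ f j → i ≡ j
  f-injective {i} {j} eq = lookup-injective xs! i j
    (injective (f~ i) (subst (λ k → List.lookup xs j ~ List.lookup ys k) (sym eq) (f~ j)))

count : {P : ℕ → Set} → Decidable P → ℕ → ℕ
count P? n = length (filter P? (upTo n))

count-suc : {P : ℕ → Set} (P? : Decidable P) (n : ℕ) →
            count P? (suc n) ≡ count P? n + length (filter P? (n ∷ []))
count-suc P? n = begin
  length (filter P? (upTo (suc n)))             ≡⟨ cong (length ∘ filter P?) (upTo-∷ʳ n) ⟨
  length (filter P? (upTo n ∷ʳ n))              ≡⟨ cong length (filter-++ P? (upTo n) (n ∷ [])) ⟩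
  length (filter P? (upTo n) ++ filter P? (n ∷ [])) ≡⟨ length-++ (filter P? (upTo n)) ⟩
  count P? n + length (filter P? (n ∷ []))      ∎
  where open ≡-Reasoning

-- The cutoff `n` may fall anywhere relative to the interval, which lets the induction on `n` go
-- through.
count-interval′ : {P : ℕ → Set} (P? : Decidable P) {a b : ℕ} →
                  (∀ {j} → P j → a ≤ j × j < b) → (∀ {j} → a ≤ j → j < b → P j) →
                  ∀ n → count P? n ≡ (b ⊓ n) ∸ a
count-interval′ P? {a} {b} P⁻ P⁺ zero = sym (trans (cong (_∸ a) (⊓-zeroʳ b)) (0∸n≡0 a))
count-interval′ P? {a} {b} P⁻ P⁺ (suc n)
  rewrite count-suc P? n | count-interval′ P? P⁻ P⁺ n with P? n
... | yes p with a≤n , n<b ← P⁻ p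
  rewrite m≥n⇒m⊓n≡n n<b | m≥n⇒m⊓n≡n (<⇒≤ n<b) =
  trans (+-comm (n ∸ a) 1) (sym (+-∸-assoc 1 a≤n))
... | no ¬p with n <? b
... | no n≮b rewrite m≤n⇒m⊓n≡m (≮⇒≥ n≮b) | m≤n⇒m⊓n≡m (m≤n⇒m≤1+n (≮⇒≥ n≮b)) = +-identityʳ _
... | yes n<b with a ≤? n
... | yes a≤n = contradiction (P⁺ a≤n n<b) ¬p
... | no  a≰n rewrite m≥n⇒m⊓n≡n n<b | m≥n⇒m⊓n≡n (<⇒≤ n<b)
                    | m≤n⇒m∸n≡0 (<⇒≤ (≰⇒> a≰n)) | m≤n⇒m∸n≡0 (≰⇒> a≰n) = refl

count-interval : {P : ℕ → Set} (P? : Decidable P) {a b n : ℕ} → b ≤ n →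
                 (∀ {j} → P j → a ≤ j × j < b) → (∀ {j} → a ≤ j → j < b → P j) →
                 count P? n ≡ b ∸ a
count-interval P? {a} {b} {n} b≤n P⁻ P⁺ =
  trans (count-interval′ P? P⁻ P⁺ n) (cong (_∸ a) (m≤n⇒m⊓n≡m b≤n))

length-filter-map : {X Y : Set} {P : Y → Set} (P? : Decidable P) (f : X → Y) (xs : List X) →
                    length (filter P? (map f xs)) ≡ length (filter (P? ∘ f) xs)
length-filter-map P? f []       = refl
length-filter-map P? f (x ∷ xs) with does (P? (f x))
... | true  = cong suc (length-filter-map P? f xs)
... | false = length-filter-map P? f xs

length-filter-cartesianProduct :
  {X Y : Set} {P : X × Y → Set} (P? : Decidable P) (xs : List X) (ys : List Y) →
  length (filter P? (cartesianProduct xs ys)) ≡ sum (map (λ x → length (filter (λ y → P? (x , y)) ys)) xs)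
length-filter-cartesianProduct P? []       ys = refl
length-filter-cartesianProduct P? (x ∷ xs) ys = begin
  length (filter P? (map (x ,_) ys ++ cartesianProduct xs ys))
    ≡⟨ cong length (filter-++ P? (map (x ,_) ys) (cartesianProduct xs ys)) ⟩
  length (filter P? (map (x ,_) ys) ++ filter P? (cartesianProduct xs ys))
    ≡⟨ length-++ (filter P? (map (x ,_) ys)) ⟩
  length (filter P? (map (x ,_) ys)) + length (filter P? (cartesianProduct xs ys))
    ≡⟨ cong₂ _+_ (length-filter-map P? (x ,_) ys) (length-filter-cartesianProduct P? xs ys) ⟩
  sum (map (λ x → length (filter (λ y → P? (x , y)) ys)) (x ∷ xs)) ∎
  where open ≡-Reasoning

sum-upTo-trailing : ∀ f {m n} → m ≤′ n → (∀ {i} → m ≤ i → f i ≡ 0) →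
                    sum (map f (upTo m)) ≡ sum (map f (upTo n))
sum-upTo-trailing f ≤′-refl h = refl
sum-upTo-trailing f {m} {suc n} (≤′-step m≤n) h = begin
  sum (map f (upTo m))                ≡⟨ sum-upTo-trailing f m≤n h ⟩
  sum (map f (upTo n))                ≡⟨ +-identityʳ _ ⟨
  sum (map f (upTo n)) + 0            ≡⟨ cong (λ x → sum (map f (upTo n)) + (x + 0)) (h (≤′⇒≤ m≤n)) ⟨
  sum (map f (upTo n)) + sum (f n ∷ []) ≡⟨ sum-++ (map f (upTo n)) (f n ∷ []) ⟨
  sum (map f (upTo n) ++ f n ∷ [])    ≡⟨ cong sum (map-++ f (upTo n) (n ∷ [])) ⟨
  sum (map f (upTo n ∷ʳ n))           ≡⟨ cong (sum ∘ map f) (upTo-∷ʳ n) ⟩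
  sum (map f (upTo (suc n)))          ∎
  where open ≡-Reasoning

excess-filter-positive : ∀ t l → excess t (filter (0 <?_) l) ≡ excess t l
excess-filter-positive t []      = refl
excess-filter-positive t (zero  ∷ l) = trans (excess-filter-positive t l) (cong (_+ excess t l) (sym (0∸n≡0 t)))
excess-filter-positive t (suc x ∷ l) = cong ((suc x ∸ t) +_) (excess-filter-positive t l)

-- Counting rectangles in a diagram whose rows are intervals

-- Both a skew shape and its transpose have this form, so the count of rectangles is done once for
-- `rows` and `cols`.
record IntervalDiagram (R : ℕ → ℕ → Set) (h w : ℕ) : Set where
  field
    lo hi       : ℕ → ℕ
    lo-antitone : ∀ {i i′} → i ≤ i′ → lo i′ ≤ lo i
    hi-antitone : ∀ {i i′} → i ≤ i′ → hi i′ ≤ hi i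
    lo≤         : ∀ {i j} → R i j → lo i ≤ j
    <hi         : ∀ {i j} → R i j → j < hi i
    inside      : ∀ {i j} → lo i ≤ j → j < hi i → R i j
    hi≤w        : ∀ i → hi i ≤ w
    hi≡0        : ∀ {i} → h ≤ i → hi i ≡ 0

Rect : (R : ℕ → ℕ → Set) (k ℓ i j : ℕ) → Set
Rect R k ℓ i j = ∀ {a} → a < k → ∀ {b} → b < ℓ → R (i + a) (j + b)

rect? : {R : ℕ → ℕ → Set} (R? : Decidable₂ R) (k ℓ : ℕ) → Decidable₂ (Rect R k ℓ)
rect? R? k ℓ i j = allUpTo? (λ a → allUpTo? (λ b → R? (i + a) (j + b)) ℓ) k

rectsOf : {R : ℕ → ℕ → Set} → Decidable₂ R → (h w k ℓ : ℕ) → List (ℕ × ℕ)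
rectsOf R? h w k ℓ = filter (λ (i , j) → rect? R? k ℓ i j) (cartesianProduct (upTo h) (upTo w))

module _ {R : ℕ → ℕ → Set} {h w : ℕ} (D : IntervalDiagram R h w) where
  open IntervalDiagram D

  Rect⁻ : ∀ {K L i j} → Rect R (suc K) (suc L) i j → lo i ≤ j × j + L < hi (i + K)
  Rect⁻ {K} {L} {i} {j} r =
    subst₂ (λ x y → lo x ≤ y) (+-identityʳ i) (+-identityʳ j) (lo≤ (r z<s z<s)) , <hi (r ≤-refl ≤-refl)

  -- As `lo` and `hi` decrease downwards, the top row is the tightest on the left and the bottom row
  -- on the right, so two opposite corners decide.
  Rect⁺ : ∀ {K L i j} → lo i ≤ j → j + L < hi (i + K) → Rect R (suc K) (suc L) i j
  Rect⁺ {K} {L} {i} {j} lo≤j j+L< (s≤s a≤K) (s≤s b≤L) = inside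
    (≤-trans (lo-antitone (m≤m+n i _)) (≤-trans lo≤j (m≤m+n j _)))
    (≤-trans (≤-<-trans (+-monoʳ-≤ j b≤L) j+L<) (hi-antitone (+-monoʳ-≤ i a≤K)))

  overlap≡ : (R? : Decidable₂ R) → ∀ K i → overlapOf R? w (suc K) i ≡ hi (i + K) ∸ lo i
  overlap≡ R? K i = count-interval _ (hi≤w (i + K))
    (λ {j} r → subst (λ x → lo x ≤ j) (+-identityʳ i) (lo≤ (r z<s)) , <hi (r ≤-refl))
    (λ lo≤j j< {a} a<k → inside (≤-trans (lo-antitone (m≤m+n i a)) lo≤j)
                                (≤-trans j< (hi-antitone (+-monoʳ-≤ i (s≤s⁻¹ a<k)))))

  -- The left edges of the rectangles with top row `i` form the interval of common columns,
  -- shortened by `L` at its right end.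
  rects-row : (R? : Decidable₂ R) → ∀ K L i →
              count (rect? R? (suc K) (suc L) i) w ≡ overlapOf R? w (suc K) i ∸ L
  rects-row R? K L i = begin
    count (rect? R? (suc K) (suc L) i) w
      ≡⟨ count-interval _ (≤-trans (m∸n≤m (hi (i + K)) L) (hi≤w (i + K)))
           (λ {j} r → let lo≤j , j< = Rect⁻ {K} {L} r in lo≤j , m+n≤o⇒m≤o∸n (suc j) j<)
           (λ {j} lo≤j j< → Rect⁺ lo≤j (subst (suc j + L ≤_) (m∸n+n≡m (L≤ j<)) (+-monoˡ-≤ L j<))) ⟩
    (hi (i + K) ∸ L) ∸ lo i             ≡⟨ ∸-+-assoc (hi (i + K)) L (lo i) ⟩
    hi (i + K) ∸ (L + lo i)             ≡⟨ cong (hi (i + K) ∸_) (+-comm L (lo i)) ⟩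
    hi (i + K) ∸ (lo i + L)             ≡⟨ ∸-+-assoc (hi (i + K)) (lo i) L ⟨
    (hi (i + K) ∸ lo i) ∸ L             ≡⟨ cong (_∸ L) (overlap≡ R? K i) ⟨
    overlapOf R? w (suc K) i ∸ L        ∎
    where
    open ≡-Reasoning
    L≤ : ∀ {j m} → j < m ∸ L → L ≤ m
    L≤ {j} {m} j< with L ≤? m
    ... | yes L≤m = L≤m
    ... | no  L≰m with () ← subst (j <_) (m≤n⇒m∸n≡0 (<⇒≤ (≰⇒> L≰m))) j<

  -- `rects-row` is summed over all rows. Sorting, omitting zeros, and omitting the runs that start
  -- at row `h ∸ K` or lower and so leave the diagram do not change the sum.
  rects-excess : (R? : Decidable₂ R) → ∀ K L →
                 length (rectsOf R? h w (suc K) (suc L)) ≡ excess L (sortedOverlaps R? h w (suc K))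
  rects-excess R? K L = begin
    length (rectsOf R? h w (suc K) (suc L))
      ≡⟨ length-filter-cartesianProduct (λ (i , j) → rect? R? (suc K) (suc L) i j) (upTo h) (upTo w) ⟩
    sum (map (λ i → count (rect? R? (suc K) (suc L) i) w) (upTo h))
      ≡⟨ cong sum (map-cong (rects-row R? K L) (upTo h)) ⟩
    sum (map (λ i → f i ∸ L) (upTo h))
      ≡⟨ sum-upTo-trailing (λ i → f i ∸ L) (≤⇒≤′ (m∸n≤m h K)) trailing ⟨
    sum (map (λ i → f i ∸ L) (upTo (h ∸ K)))
      ≡⟨ cong sum (map-∘ (upTo (h ∸ K))) ⟩
    excess L (map f (upTo (h ∸ K)))
      ≡⟨ excess-filter-positive L (map f (upTo (h ∸ K))) ⟨
    excess L (filter (0 <?_) (map f (upTo (h ∸ K))))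
      ≡⟨ sum-↭ (↭-map⁺ (_∸ L) (Descending.sort-↭ (filter (0 <?_) (map f (upTo (h ∸ K)))))) ⟨
    excess L (sortedOverlaps R? h w (suc K)) ∎
    where
    open ≡-Reasoning
    f = overlapOf R? w (suc K)

    trailing : ∀ {i} → h ∸ K ≤ i → f i ∸ L ≡ 0
    trailing {i} h∸K≤i = trans
      (cong (_∸ L) (trans (overlap≡ R? K i)
        (trans (cong (_∸ lo i) (hi≡0 (m∸n≤o⇒m≤o+n h∸K≤i))) (0∸n≡0 (lo i)))))
      (0∸n≡0 L)
      where
      m∸n≤o⇒m≤o+n : h ∸ K ≤ i → h ≤ i + K
      m∸n≤o⇒m≤o+n le = ≤-trans (m≤n+m∸n h K) (subst (_≤ i + K) (+-comm (h ∸ K) K) (+-monoˡ-≤ K le))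

sortedOverlaps-decreasing : {R : ℕ → ℕ → Set} (R? : Decidable₂ R) → ∀ h w k →
                            AllPairs _≥_ (sortedOverlaps R? h w k)
sortedOverlaps-decreasing R? h w k =
  Linked⇒AllPairs (flip ≤-trans) (Descending.sort-↗ (filter (0 <?_) (map (overlapOf R? w k) (upTo (suc h ∸ k)))))

∈rectsOf⁺ : {R : ℕ → ℕ → Set} (R? : Decidable₂ R) → ∀ h w k ℓ {i j} → i < h → j < w →
            Rect R k ℓ i j → (i , j) ∈ rectsOf R? h w k ℓ
∈rectsOf⁺ R? h w k ℓ i< j< r = ∈-filter⁺ (λ (i , j) → rect? R? k ℓ i j)
  (∈-cartesianProduct⁺ (∈-upTo⁺ i<) (∈-upTo⁺ j<)) r

∈rectsOf⁻ : {R : ℕ → ℕ → Set} (R? : Decidable₂ R) → ∀ h w k ℓ {i j} →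
            (i , j) ∈ rectsOf R? h w k ℓ → i < h × j < w × Rect R k ℓ i j
∈rectsOf⁻ R? h w k ℓ ∈rects
  with ∈product , r ← ∈-filter⁻ (λ (i , j) → rect? R? k ℓ i j) {xs = cartesianProduct (upTo h) (upTo w)} ∈rects
  with i∈ , j∈ ← ∈-cartesianProduct⁻ (upTo h) (upTo w) ∈product
  = ∈-upTo⁻ i∈ , ∈-upTo⁻ j∈ , r

rectsOf-unique : {R : ℕ → ℕ → Set} (R? : Decidable₂ R) → ∀ h w k ℓ → Unique (rectsOf R? h w k ℓ)
rectsOf-unique R? h w k ℓ = Unique.filter⁺ (λ (i , j) → rect? R? k ℓ i j)
  (Unique.cartesianProduct⁺ (Unique.upTo⁺ h) (Unique.upTo⁺ w))

rectsOf-flip-≤ : {R : ℕ → ℕ → Set} (R? : Decidable₂ R) → ∀ h w k ℓ →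
                 length (rectsOf R? h w k ℓ) ≤ length (rectsOf (flip R?) w h ℓ k)
rectsOf-flip-≤ R? h w k ℓ =
  length-≤-via {ys = rectsOf (flip R?) w h ℓ k} (λ x y → x ≡ swap y) (rectsOf-unique R? h w k ℓ)
    (λ {x} x∈ → let i< , j< , r = ∈rectsOf⁻ R? h w k ℓ x∈ in
      swap x , ∈rectsOf⁺ (flip R?) w h ℓ k j< i< (λ b< a< → r a< b<) , refl)
    (λ x≡ x′≡ → trans x≡ (sym x′≡))

rectsOf-flip : {R : ℕ → ℕ → Set} (R? : Decidable₂ R) → ∀ h w k ℓ →
               length (rectsOf R? h w k ℓ) ≡ length (rectsOf (flip R?) w h ℓ k)
rectsOf-flip R? h w k ℓ = ≤-antisym (rectsOf-flip-≤ R? h w k ℓ) (rectsOf-flip-≤ (flip R?) w h ℓ k)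

-- Skew shapes and their transposes as interval diagrams

decreasing⇒AllPairs : (π : Partition) → AllPairs _≥_ (Partition.parts π)
decreasing⇒AllPairs π = Linked⇒AllPairs (flip ≤-trans) (Partition.decreasing π)

part-antitone : ∀ {l} → AllPairs _≥_ l → ∀ {i i′} → i ≤ i′ → part l i′ ≤ part l i
part-antitone []        _                       = z≤n
part-antitone (x≥ ∷ _)  {zero}  {zero}   _       = ≤-refl
part-antitone (x≥ ∷ _)  {zero}  {suc i′} _       = part-≤ x≥ i′
part-antitone (_ ∷ l≥)  {suc i} {suc i′} (s≤s p) = part-antitone l≥ p

part-length : ∀ l {i} → length l ≤ i → part l i ≡ 0
part-length []      _       = refl
part-length (x ∷ l) (s≤s p) = part-length l p

conjugate : List ℕ → ℕ → ℕ
conjugate []      j = 0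
conjugate (x ∷ l) j with x ≤? j
... | yes _ = 0
... | no  _ = suc (conjugate l j)

conjugate-≤-length : ∀ l j → conjugate l j ≤ length l
conjugate-≤-length []      j = z≤n
conjugate-≤-length (x ∷ l) j with x ≤? j
... | yes _ = z≤n
... | no  _ = s≤s (conjugate-≤-length l j)

part≤⇒conjugate≤ : ∀ l {i j} → part l i ≤ j → conjugate l j ≤ i
part≤⇒conjugate≤ []      _ = z≤n
part≤⇒conjugate≤ (x ∷ l) {i} {j} p with x ≤? j
part≤⇒conjugate≤ (x ∷ l) {i}     p | yes _   = z≤n
part≤⇒conjugate≤ (x ∷ l) {zero}  p | no  x≰j = contradiction p x≰j
part≤⇒conjugate≤ (x ∷ l) {suc i} p | no  _   = s≤s (part≤⇒conjugate≤ l p)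

-- With `part≤⇒conjugate≤` this is a Galois connection, from which the facts about columns follow.
-- Once the scan in `conjugate` stops at a part at most `j`, all later parts are at most `j` too.
conjugate≤⇒part≤ : ∀ {l} → AllPairs _≥_ l → ∀ {i j} → conjugate l j ≤ i → part l i ≤ j
conjugate≤⇒part≤ []                    _ = z≤n
conjugate≤⇒part≤ {x ∷ l} (x≥ ∷ l≥) {i} {j} p with x ≤? j
conjugate≤⇒part≤ {x ∷ l} (x≥ ∷ l≥) {i}     p       | yes x≤j =
  ≤-trans (part-antitone (x≥ ∷ l≥) {0} {i} z≤n) x≤j
conjugate≤⇒part≤ {x ∷ l} (x≥ ∷ l≥) {suc i} (s≤s p) | no  _   = conjugate≤⇒part≤ l≥ p

conjugate-antitone : ∀ {l} → AllPairs _≥_ l → ∀ {j j′} → j ≤ j′ → conjugate l j′ ≤ conjugate l j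
conjugate-antitone {l} l≥ j≤j′ = part≤⇒conjugate≤ l (≤-trans (conjugate≤⇒part≤ l≥ ≤-refl) j≤j′)

module _ (A : SkewShape) where
  open SkewShape A

  private
    outer≥ = decreasing⇒AllPairs outer
    inner≥ = decreasing⇒AllPairs inner

  rowDiagram : IntervalDiagram (Box A) height width
  rowDiagram = record
    { lo          = part innerParts
    ; hi          = part outerParts
    ; lo-antitone = part-antitone inner≥
    ; hi-antitone = part-antitone outer≥
    ; lo≤         = proj₁
    ; <hi         = proj₂
    ; inside      = _,_
    ; hi≤w        = λ i → part-antitone outer≥ {0} {i} z≤n
    ; hi≡0        = part-length outerParts
    }

  colDiagram : IntervalDiagram (flip (Box A)) width height
  colDiagram = record
    { lo          = conjugate innerParts
    ; hi          = conjugate outerParts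
    ; lo-antitone = conjugate-antitone inner≥
    ; hi-antitone = conjugate-antitone outer≥
    ; lo≤         = λ (lo≤ , _) → part≤⇒conjugate≤ innerParts lo≤
    ; <hi         = λ (_ , <hi) → ≰⇒> (λ le → <⇒≱ <hi (conjugate≤⇒part≤ outer≥ le))
    ; inside      = λ lo≤ <hi → conjugate≤⇒part≤ inner≥ lo≤ ,
                                ≰⇒> (λ le → <⇒≱ <hi (part≤⇒conjugate≤ outerParts le))
    ; hi≤w        = conjugate-≤-length outerParts
    ; hi≡0        = λ w≤j → n≤0⇒n≡0 (part≤⇒conjugate≤ outerParts w≤j)
    }

  rects≡excess-rows : ∀ K L → rects (suc K) (suc L) A ≡ excess L (rows (suc K) A)
  rects≡excess-rows = rects-excess rowDiagram (box? A)

  rects≡excess-cols : ∀ K L → rects (suc K) (suc L) A ≡ excess K (cols (suc L) A)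
  rects≡excess-cols K L = trans (rectsOf-flip (box? A) height width (suc K) (suc L))
                                (rects-excess colDiagram (flip (box? A)) L K)

  rows-decreasing : ∀ k → AllPairs _≥_ (rows k A)
  rows-decreasing = sortedOverlaps-decreasing (box? A) height width

  cols-decreasing : ∀ ℓ → AllPairs _≥_ (cols ℓ A)
  cols-decreasing = sortedOverlaps-decreasing (flip (box? A)) width height

-- Standard Young tableaux

injective⇒surjective : ∀ {n} (f : Fin n → Fin n) → (∀ {p q} → f p ≡ f q → p ≡ q) → ∀ v → ∃ λ p → f p ≡ v
injective⇒surjective {suc n} f f-injective v with Fin.any? (λ p → f p Fin.≟ v)
... | yes found = found
... | no ¬found = contradiction
  (Fin.injective⇒≤ {f = λ p → punchOut (v≢f p)} (λ {p} {q} eq → f-injective (Fin.punchOut-injective (v≢f p) (v≢f q) eq)))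
  1+n≰n
  where
  v≢f : ∀ p → v ≢ f p
  v≢f p eq = ¬found (p , sym eq)

-- Standardization: natural number keys are replaced by their ranks, which gives a filling in the
-- same order.
module Rank {n} (key : Fin n → ℕ) where

  rank : Fin n → ℕ
  rank p = length (filter (λ q → key q <? key p) (allFin n))

  rank<n : ∀ p → rank p < n
  rank<n p = subst (rank p <_) (length-tabulate id)
    (filter-notAll (λ q → key q <? key p) (allFin n) (lose (∈-allFin p) (<-irrefl refl)))

  rank-mono-< : ∀ {p q} → key p < key q → rank p < rank q
  rank-mono-< {p} {q} p<q = length-≤-via {xs = p ∷ filter (λ r → key r <? key p) (allFin n)} _≡_
    (All.tabulate (λ {r} r∈ → λ { refl → <-irrefl refl (below r∈) }) ∷
      Unique.filter⁺ (λ r → key r <? key p) (Unique.allFin⁺ n))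
    (λ { {r} (here refl) → r , ∈-filter⁺ (λ r → key r <? key q) (∈-allFin r) p<q , refl
       ; {r} (there r∈)  → r , ∈-filter⁺ (λ r → key r <? key q) (∈-allFin r) (<-trans (below r∈) p<q) , refl })
    (λ eq eq′ → trans eq (sym eq′))
    where
    below : ∀ {r} → r ∈ filter (λ r → key r <? key p) (allFin n) → key r < key p
    below r∈ = proj₂ (∈-filter⁻ (λ r → key r <? key p) {xs = allFin n} r∈)

  ranking : Vec (Fin n) n
  ranking = Vec.tabulate (λ p → fromℕ< (rank<n p))

  toℕ-ranking : ∀ p → toℕ (Vec.lookup ranking p) ≡ rank p
  toℕ-ranking p = trans (cong toℕ (Vec.lookup∘tabulate _ p)) (Fin.toℕ-fromℕ< (rank<n p))

module Position (A : SkewShape) where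
  open SkewShape A

  boxes-unique : Unique (boxes A)
  boxes-unique = Unique.filter⁺ (λ (i , j) → box? A i j)
    (Unique.cartesianProduct⁺ (Unique.upTo⁺ height) (Unique.upTo⁺ width))

  position-injective : ∀ p q → row A p ≡ row A q → col A p ≡ col A q → p ≡ q
  position-injective p q r≡ c≡ = lookup-injective boxes-unique p q (cong₂ _,_ r≡ c≡)

  isBox : ∀ p → Box A (row A p) (col A p)
  isBox p = proj₂ (∈-filter⁻ (λ (i , j) → box? A i j) {xs = cartesianProduct (upTo height) (upTo width)} (∈-lookup p))

  box<height : ∀ {i j} → Box A i j → i < height
  box<height (_ , j<) = ≰⇒> (λ h≤i → n≮0 (subst (_ <_) (part-length outerParts h≤i) j<))

  box<width : ∀ {i j} → Box A i j → j < width
  box<width {i} (_ , j<) = ≤-trans j< (IntervalDiagram.hi≤w (rowDiagram A) i)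

  position : ∀ {i j} → Box A i j → ∃ λ p → row A p ≡ i × col A p ≡ j
  position {i} {j} b = index ij∈ , sym (cong proj₁ (lookup-index ij∈)) , sym (cong proj₂ (lookup-index ij∈))
    where
    ij∈ : (i , j) ∈ boxes A
    ij∈ = ∈-filter⁺ (λ (i , j) → box? A i j)
      (∈-cartesianProduct⁺ (∈-upTo⁺ (box<height b)) (∈-upTo⁺ (box<width b))) b

module Tableau (A : SkewShape) (T : Filling A) (syt : IsSYT A T) where
  open IsSYT syt

  hasEntry : ∀ {m} → 0 < m → m ≤ size A → ∃ λ p → entry A T p ≡ m
  hasEntry {suc m} _ m< =
    let p , eq = injective⇒surjective (Vec.lookup T) (λ {p} {q} eq → injective p q (cong (suc ∘ toℕ) eq)) (fromℕ< m<)
    in p , cong suc (trans (cong toℕ eq) (Fin.toℕ-fromℕ< m<))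

  entry≤size : ∀ p → entry A T p ≤ size A
  entry≤size p = Fin.toℕ<n (Vec.lookup T p)

  descent⇒row< : ∀ {p q} → entry A T q ≡ suc (entry A T p) → Descent A T (entry A T p) → row A p < row A q
  descent⇒row< {p} {q} eq (p′ , q′ , eqp , eqq , r<) =
    subst₂ (λ p q → row A p < row A q) (injective p′ p eqp) (injective q′ q (trans eqq (sym eq))) r<

  private
    predecessor : ∀ {p q m} → entry A T q ≡ suc m → entry A T p ≤ m → ∃ λ r → entry A T r ≡ m
    predecessor {p} {q} eq p≤m = hasEntry (≤-trans z<s p≤m)
      (≤-trans (n≤1+n _) (subst (_≤ size A) eq (entry≤size q)))

  -- Walk through the entries from `p` to `q` one at a time: where `i` is no descent, the box of
  -- `i + 1` is not lower than that of `i`.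
  noDescents⇒row≥ : ∀ {p q} → entry A T p ≤ entry A T q →
    (∀ {i} → entry A T p ≤ i → i < entry A T q → ¬ Descent A T i) → row A q ≤ row A p
  noDescents⇒row≥ {p} p≤q = go _ p≤q refl
    where
    go : ∀ m {q} → entry A T p ≤ m → entry A T q ≡ m →
         (∀ {i} → entry A T p ≤ i → i < m → ¬ Descent A T i) → row A q ≤ row A p
    go m {q} p≤m eq none with m≤n⇒m<n∨m≡n p≤m
    go m {q} p≤m eq none | inj₂ p≡m = ≤-reflexive (cong (row A) (injective q p (trans eq (sym p≡m))))
    go (suc m) {q} p≤m eq none | inj₁ (s≤s p≤m′) =
      let r , r≡m = predecessor {p} {q} eq p≤m′ in
      ≤-trans (≮⇒≥ (λ r<q → none p≤m′ ≤-refl (r , q , r≡m , eq , r<q)))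
              (go m p≤m′ r≡m (λ p≤i i<m → none p≤i (m≤n⇒m≤1+n i<m)))

  allDescents⇒row< : ∀ {p q} → entry A T p < entry A T q →
    (∀ {i} → entry A T p ≤ i → i < entry A T q → Descent A T i) → row A p < row A q
  allDescents⇒row< {p} p<q = go _ p<q refl
    where
    go : ∀ m {q} → entry A T p < m → entry A T q ≡ m →
         (∀ {i} → entry A T p ≤ i → i < m → Descent A T i) → row A p < row A q
    go (suc m) {q} (s≤s p≤m) eq all with m≤n⇒m<n∨m≡n p≤m
    ... | inj₂ refl = descent⇒row< {p} {q} eq (all ≤-refl ≤-refl)
    ... | inj₁ p<m  =
      let r , r≡m = predecessor {p} {q} eq p≤m in
      <-trans (go m p<m r≡m (λ p≤i i<m → all p≤i (m≤n⇒m≤1+n i<m)))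
              (descent⇒row< {r} {q} (trans eq (cong suc (sym r≡m)))
                (subst (Descent A T) (sym r≡m) (all p≤m ≤-refl)))

-- The layered tableau

+-*-mono-< : ∀ {N a b x} y → x < N → a < b → a * N + x < b * N + y
+-*-mono-< {N} {a} {b} {x} y x<N a<b = begin-strict
  a * N + x  <⟨ +-monoʳ-< (a * N) x<N ⟩
  a * N + N  ≡⟨ +-comm (a * N) N ⟩
  suc a * N  ≤⟨ *-monoˡ-≤ N a<b ⟩
  b * N      ≤⟨ m≤m+n (b * N) y ⟩
  b * N + y  ∎
  where open ≤-Reasoning

-- The tableau of shape B that first fills the top K boxes of every
-- column, layer by layer, each layer from left to right, and then the
-- boxes left in every row, again layer by layer, each layer downwards.
module Layered (B : SkewShape) (K : ℕ) where
  open SkewShape B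
  open Position B

  private
    lo top : ℕ → ℕ
    lo  = part innerParts
    top = conjugate innerParts

    inner≥ : AllPairs _≥_ innerParts
    inner≥ = decreasing⇒AllPairs inner

  -- The last two indices are the number of the layer and the place within it. Horizontal layers are
  -- numbered by the depth in the column; the vertical ones follow, numbered from `K`. In row `i`
  -- these start at column `lo (i ∸ K)`, because `top j + K ≤ i` amounts to `lo (i ∸ K) ≤ j`.
  data Layer (i j : ℕ) : ℕ → ℕ → Set where
    horizontal : ∀ {c} → c < K → i ≡ top j + c → Layer i j c j
    vertical   : ∀ {e} → K ≤ i → j ≡ lo (i ∸ K) + e → Layer i j (K + e) i

  layer : ∀ {i j} → Box B i j → ∃₂ (Layer i j)
  layer {i} {j} (lo≤j , _) with i ∸ top j <? K
  ... | yes d<K = _ , _ , horizontal d<K (sym (m+[n∸m]≡n (part≤⇒conjugate≤ innerParts lo≤j)))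
  ... | no  d≮K = _ , _ , vertical (≤-trans K≤d (m∸n≤m i (top j)))
      (sym (m+[n∸m]≡n (conjugate≤⇒part≤ inner≥ top≤)))
    where
    K≤d = ≮⇒≥ d≮K
    top≤ : top j ≤ i ∸ K
    top≤ = m+n≤o⇒m≤o∸n (top j) (subst (top j + K ≤_) (m+[n∸m]≡n (part≤⇒conjugate≤ innerParts lo≤j))
                                       (+-monoʳ-≤ (top j) K≤d))

  infix 4 _⊏_
  _⊏_ : ℕ × ℕ → ℕ × ℕ → Set
  (c , x) ⊏ (c′ , x′) = c < c′ ⊎ c ≡ c′ × x < x′

  private
    vertical-top : ∀ {i j e} → j ≡ lo (i ∸ K) + e → K ≤ i → top j + K ≤ i
    vertical-top {i} {j} j≡ K≤i = subst (top j + K ≤_) (m∸n+n≡m K≤i)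
      (+-monoˡ-≤ K (part≤⇒conjugate≤ innerParts (subst (lo (i ∸ K) ≤_) (sym j≡) (m≤m+n _ _))))

  -- Columns further right start no lower, so the depth weakly increases along a row, and ties are
  -- broken by the column. For the same reason no horizontal box lies to the right of a vertical
  -- one.
  layer-row : ∀ {i j j′ c c′ x x′} → Layer i j c x → Layer i j′ c′ x′ → j < j′ → (c , x) ⊏ (c′ , x′)
  layer-row {j = j} {j′} {c} {c′} (horizontal _ i≡) (horizontal _ i≡′) j<j′
    with m≤n⇒m<n∨m≡n c≤c′
    where
    c≤c′ : c ≤ c′
    c≤c′ = +-cancelˡ-≤ (top j′) c c′ (begin
      top j′ + c  ≤⟨ +-monoˡ-≤ c (conjugate-antitone inner≥ (<⇒≤ j<j′)) ⟩
      top j + c   ≡⟨ trans (sym i≡) i≡′ ⟩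
      top j′ + c′ ∎)
      where open ≤-Reasoning
  ... | inj₁ c<c′ = inj₁ c<c′
  ... | inj₂ c≡c′ = inj₂ (c≡c′ , j<j′)
  layer-row (horizontal c<K _) (vertical _ _) _ = inj₁ (≤-trans c<K (m≤m+n K _))
  layer-row {i} {j} {j′} (vertical K≤i j≡) (horizontal c<K i≡) j<j′ = contradiction
    (≤-trans (+-monoˡ-≤ K (conjugate-antitone inner≥ (<⇒≤ j<j′))) (≤-trans (vertical-top j≡ K≤i) (≤-reflexive i≡)))
    (<⇒≱ (+-monoʳ-< (top j′) c<K))
  layer-row {i} (vertical {e} _ refl) (vertical {e′} _ refl) j<j′ =
    inj₁ (+-monoʳ-< K (+-cancelˡ-< (lo (i ∸ K)) e e′ j<j′))

  -- Down a column, depths strictly increase. Among vertical boxes `lo (i ∸ K)` weakly decreases, so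
  -- the layer weakly increases, and ties are broken by the row.
  layer-col : ∀ {i i′ j c c′ x x′} → Layer i j c x → Layer i′ j c′ x′ → i < i′ → (c , x) ⊏ (c′ , x′)
  layer-col {j = j} {c} {c′} (horizontal _ refl) (horizontal _ refl) i<i′ = inj₁ (+-cancelˡ-< (top j) c c′ i<i′)
  layer-col (horizontal c<K _) (vertical _ _) _ = inj₁ (≤-trans c<K (m≤m+n K _))
  layer-col {i} {j = j} (vertical K≤i j≡) (horizontal c<K refl) i<i′ = contradiction
    (≤-trans (vertical-top j≡ K≤i) (<⇒≤ i<i′)) (<⇒≱ (+-monoʳ-< (top j) c<K))
  layer-col {i} {i′} (vertical {e} _ j≡) (vertical {e′} _ j≡′) i<i′ with m≤n⇒m<n∨m≡n e≤e′
    where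
    e≤e′ : e ≤ e′
    e≤e′ = +-cancelˡ-≤ (lo (i′ ∸ K)) e e′ (begin
      lo (i′ ∸ K) + e  ≤⟨ +-monoˡ-≤ e (part-antitone inner≥ (∸-monoˡ-≤ K (<⇒≤ i<i′))) ⟩
      lo (i ∸ K) + e   ≡⟨ trans (sym j≡) j≡′ ⟩
      lo (i′ ∸ K) + e′ ∎)
      where open ≤-Reasoning
  ... | inj₁ e<e′ = inj₁ (+-monoʳ-< K e<e′)
  ... | inj₂ e≡e′ = inj₂ (cong (K +_) e≡e′ , i<i′)

  horizontal-rows : ∀ {i j i′ j′ c x x′} → Layer i j c x → Layer i′ j′ c x′ → c < K → x < x′ → i′ ≤ i
  horizontal-rows {c = c} (horizontal _ refl) (horizontal _ refl) _ j<j′ =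
    +-monoˡ-≤ c (conjugate-antitone inner≥ (<⇒≤ j<j′))
  horizontal-rows (vertical _ _) _ c<K _ = contradiction c<K (m+n≮m K _)
  horizontal-rows (horizontal _ _) (vertical _ _) c<K _ = contradiction c<K (m+n≮m K _)

  vertical-row : ∀ {i j c x} → Layer i j c x → K ≤ c → x ≡ i
  vertical-row (horizontal c<K _) K≤c = contradiction K≤c (<⇒≱ c<K)
  vertical-row (vertical _ _)     _   = refl

  -- From layer `K + L` on, the box `K` rows up and `L` columns to the left is still outside the
  -- inner shape, which is the left condition of `Rect⁺`.
  vertical-corner : ∀ {i j c x L} → Layer i j c x → K + L ≤ c → K ≤ i × lo (i ∸ K) + L ≤ j
  vertical-corner (horizontal c<K _) KL≤c = contradiction (m+n≤o⇒m≤o K KL≤c) (<⇒≱ c<K)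
  vertical-corner {i} {L = L} (vertical {e} K≤i refl) KL≤c =
    K≤i , +-monoʳ-≤ (lo (i ∸ K)) (+-cancelˡ-≤ K L e KL≤c)

  layer-injective : ∀ {i j i′ j′ c c′ x x′} → Layer i j c x → Layer i′ j′ c′ x′ → c ≡ c′ → x ≡ x′ → i ≡ i′ × j ≡ j′
  layer-injective (horizontal _ refl) (horizontal _ refl) refl refl = refl , refl
  layer-injective (horizontal c<K _) (vertical _ _) refl _ = contradiction c<K (m+n≮m K _)
  layer-injective (vertical _ _) (horizontal c<K _) refl _ = contradiction c<K (m+n≮m K _)
  layer-injective (vertical {e} _ j≡) (vertical {e′} _ j≡′) c≡ refl
    rewrite +-cancelˡ-≡ K e e′ c≡ = refl , trans j≡ (sym j≡′)

  along< : ∀ {i j c x} → Box B i j → Layer i j c x → x < height + width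
  along< b (horizontal _ _) = ≤-trans (box<width b) (m≤n+m width height)
  along< b (vertical _ _)   = ≤-trans (box<height b) (m≤m+n height width)

  module _ (p : Fin (size B)) where
    private
      l : ∃₂ (Layer (row B p) (col B p))
      l = layer (isBox p)

    layerOf along : ℕ
    layerOf = proj₁ l
    along   = proj₁ (proj₂ l)

    layerAt : Layer (row B p) (col B p) layerOf along
    layerAt = proj₂ (proj₂ l)

    key : ℕ
    -- Lexicographic order on layer and place. The place is a column or row index, hence below the
    -- base `height + width`.
    key = layerOf * (height + width) + along

  along<N : ∀ p → along p < height + width
  along<N p = along< (isBox p) (layerAt p)

  ⊏⇒key< : ∀ {p q} → (layerOf p , along p) ⊏ (layerOf q , along q) → key p < key q
  ⊏⇒key< {p} {q} (inj₁ c<c′) = +-*-mono-< (along q) (along<N p) c<c′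
  ⊏⇒key< {p} {q} (inj₂ (c≡c′ , x<x′)) =
    subst (λ c → key p < c * (height + width) + along q) c≡c′ (+-monoʳ-< (layerOf p * (height + width)) x<x′)

  key≤⇒layer≤ : ∀ {p q} → key p ≤ key q → layerOf p ≤ layerOf q
  key≤⇒layer≤ {p} {q} le = ≮⇒≥ (λ c′<c → <⇒≱ (+-*-mono-< (along p) (along<N q) c′<c) le)

  key<⇒along< : ∀ {p q} → key p < key q → layerOf p ≡ layerOf q → along p < along q
  key<⇒along< {p} {q} lt c≡c′ = +-cancelˡ-< (layerOf p * (height + width)) (along p) (along q)
    (subst (λ c → key p < c * (height + width) + along q) (sym c≡c′) lt)

  key-injective : ∀ p q → key p ≡ key q → p ≡ q
  key-injective p q eq =
    let c≡ = ≤-antisym (key≤⇒layer≤ {p} {q} (≤-reflexive eq)) (key≤⇒layer≤ {q} {p} (≤-reflexive (sym eq)))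
        x≡ = +-cancelˡ-≡ (layerOf q * (height + width)) (along p) (along q)
               (subst (λ c → c * (height + width) + along p ≡ key q) c≡ eq)
        i≡ , j≡ = layer-injective (layerAt p) (layerAt q) c≡ x≡
    in position-injective p q i≡ j≡

  open Rank key

  U : Filling B
  U = ranking

  private
    e : Fin (size B) → ℕ
    e = entry B U

  key<⇒entry< : ∀ {p q} → key p < key q → e p < e q
  key<⇒entry< {p} {q} lt = s≤s (subst₂ _<_ (sym (toℕ-ranking p)) (sym (toℕ-ranking q)) (rank-mono-< {p} {q} lt))

  entry≤⇒key≤ : ∀ {p q} → e p ≤ e q → key p ≤ key q
  entry≤⇒key≤ {p} {q} le = ≮⇒≥ (λ lt → <⇒≱ (key<⇒entry< {q} {p} lt) le)

  entry<⇒key< : ∀ {p q} → e p < e q → key p < key q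
  entry<⇒key< {p} {q} lt = ≤∧≢⇒< (entry≤⇒key≤ {p} {q} (<⇒≤ lt))
    (λ eq → <-irrefl (cong e (key-injective p q eq)) lt)

  U-SYT : IsSYT B U
  U-SYT = isSYT
    (λ p q eq → key-injective p q
      (≤-antisym (entry≤⇒key≤ {p} {q} (≤-reflexive eq)) (entry≤⇒key≤ {q} {p} (≤-reflexive (sym eq)))))
    (λ p q r≡ c< → key<⇒entry< {p} {q} (⊏⇒key< {p} {q}
      (layer-row (subst (λ i → Layer i _ _ _) r≡ (layerAt p)) (layerAt q) c<)))
    (λ p q c≡ r< → key<⇒entry< {p} {q} (⊏⇒key< {p} {q}
      (layer-col (subst (λ j → Layer _ j _ _) c≡ (layerAt p)) (layerAt q) r<)))

  private
    -- The key orders by layer first, so the entries of one layer are consecutive.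
    between : ∀ {p q r} → layerOf p ≡ layerOf q → e p ≤ e r → e r ≤ e q → layerOf r ≡ layerOf p
    between {p} {q} {r} c≡ p≤r r≤q = ≤-antisym
      (≤-trans (key≤⇒layer≤ {r} {q} (entry≤⇒key≤ {r} {q} r≤q)) (≤-reflexive (sym c≡)))
      (key≤⇒layer≤ {p} {r} (entry≤⇒key≤ {p} {r} p≤r))

  horizontal-noDescent : ∀ {p q} → layerOf p ≡ layerOf q → layerOf p < K →
                         ∀ {i} → e p ≤ i → i < e q → ¬ Descent B U i
  horizontal-noDescent {p} {q} c≡ c<K p≤i i<q (r , r′ , refl , er′ , r<r′) =
    <⇒≱ r<r′ (horizontal-rows (layerAt r) (subst (λ c → Layer _ _ c _) (trans cr′ (sym cr)) (layerAt r′))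
      (subst (_< K) (sym cr) c<K)
      (key<⇒along< {r} {r′} (entry<⇒key< {r} {r′} (≤-reflexive (sym er′))) (trans cr (sym cr′))))
    where
    cr  = between {p} {q} {r} c≡ p≤i (<⇒≤ i<q)
    cr′ = between {p} {q} {r′} c≡ (≤-trans p≤i (≤-trans (n≤1+n _) (≤-reflexive (sym er′))))
                                  (≤-trans (≤-reflexive er′) i<q)

  -- The boxes of `i` and `i + 1` lie in the same vertical layer, where the place is the row itself,
  -- so the later one is strictly lower.
  vertical-descent : ∀ {p q} → layerOf p ≡ layerOf q → K ≤ layerOf p →
                     ∀ {i} → e p ≤ i → i < e q → Descent B U i
  vertical-descent {p} {q} c≡ K≤c {i} p≤i i<q =
    let r  , er  = hasEntry (≤-trans z<s p≤i) (≤-trans (<⇒≤ i<q) (entry≤size q))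
        r′ , er′ = hasEntry z<s (≤-trans i<q (entry≤size q))
        cr  = between {p} {q} {r} c≡ (≤-trans p≤i (≤-reflexive (sym er))) (≤-trans (≤-reflexive er) (<⇒≤ i<q))
        cr′ = between {p} {q} {r′} c≡ (≤-trans p≤i (≤-trans (n≤1+n _) (≤-reflexive (sym er′))))
                                      (≤-trans (≤-reflexive er′) i<q)
    in r , r′ , er , er′ ,
       subst₂ _<_ (vertical-row (layerAt r) (≤-trans K≤c (≤-reflexive (sym cr))))
                  (vertical-row (layerAt r′) (≤-trans K≤c (≤-reflexive (sym cr′))))
         (key<⇒along< {r} {r′}
           (entry<⇒key< {r} {r′} (≤-trans (≤-reflexive (cong suc er)) (≤-reflexive (sym er′)))) (trans cr (sym cr′)))
    where open Tableau B U U-SYT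

-- Transfer of rectangle corners from A to B

module Transfer (A B : SkewShape) (K : ℕ) (T : Filling A) (syt : IsSYT A T)
                (comp≡ : comp A T ≡ comp B (Layered.U B K)) where
  open IsSYT syt
  open Layered B K
  private
    module TA = Tableau A T syt
    module TB = Tableau B U U-SYT
    module PA = Position A
    module PB = Position B

  partner : ∀ p → ∃ λ q → entry B U q ≡ entry A T p
  partner p = TB.hasEntry z<s (subst (entry A T p ≤_) (comp≡⇒size A B T U comp≡) (TA.entry≤size p))

  layerOfPartner : Fin (size A) → ℕ
  layerOfPartner p = layerOf (proj₁ (partner p))

  private
    layer-≤ : ∀ {p p′} → entry A T p < entry A T p′ → layerOfPartner p ≤ layerOfPartner p′
    layer-≤ {p} {p′} lt = key≤⇒layer≤ {proj₁ (partner p)} {proj₁ (partner p′)}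
      (entry≤⇒key≤ {proj₁ (partner p)} {proj₁ (partner p′)}
        (subst₂ _≤_ (sym (proj₂ (partner p))) (sym (proj₂ (partner p′))) (<⇒≤ lt)))

  -- If both partners were in one horizontal layer, `U` and hence `T` would have no descent between
  -- the two entries, and `p′` could not be lower than `p`.
  column-layers : ∀ {p p′} → col A p ≡ col A p′ → row A p < row A p′ →
                  layerOfPartner p′ < K → layerOfPartner p < layerOfPartner p′
  column-layers {p} {p′} c≡ r< c′<K = ≤∧≢⇒< (layer-≤ {p} {p′} lt) λ eq →
    <⇒≱ r< (TA.noDescents⇒row≥ {p} {p′} (<⇒≤ lt) λ {i} p≤i i<p′ d →
      horizontal-noDescent {proj₁ (partner p)} {proj₁ (partner p′)} eq (subst (_< K) (sym eq) c′<K)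
        (subst (_≤ i) (sym (proj₂ (partner p))) p≤i) (subst (i <_) (sym (proj₂ (partner p′))) i<p′)
        (comp≡⇒descent A B T U comp≡ d))
    where lt = colsIncrease p p′ c≡ r<

  -- If both partners were in one vertical layer, every step between the two entries would be a
  -- descent of `T`, placing `p′` strictly lower than `p`.
  row-layers : ∀ {p p′} → row A p ≡ row A p′ → col A p < col A p′ →
               K ≤ layerOfPartner p → layerOfPartner p < layerOfPartner p′
  row-layers {p} {p′} r≡ c< K≤c = ≤∧≢⇒< (layer-≤ {p} {p′} lt) λ eq →
    <-irrefl r≡ (TA.allDescents⇒row< {p} {p′} lt λ {i} p≤i i<p′ →
      comp≡⇒descent B A U T (sym comp≡)
        (vertical-descent {proj₁ (partner p)} {proj₁ (partner p′)} eq K≤c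
          (subst (_≤ i) (sym (proj₂ (partner p))) p≤i) (subst (i <_) (sym (proj₂ (partner p′))) i<p′)))
    where lt = rowsIncrease p p′ r≡ c<

  private
    -- Each step down raises the layer of the partner as long as it stays below `K`; once it reaches
    -- `K`, the bound holds because `a ≤ K`.
    layer-in-column : ∀ a {i j p} → a ≤ K → (∀ {a′} → a′ ≤ a → Box A (i + a′) j) →
                      row A p ≡ i + a → col A p ≡ j → a ≤ layerOfPartner p
    layer-in-column zero    _ _ _ _ = z≤n
    layer-in-column (suc a) {i} {j} {p} a<K inA r≡ c≡ = [ ≤-trans a<K , step ]′ (≤-<-connex K (layerOfPartner p))
      where
      step : layerOfPartner p < K → suc a ≤ layerOfPartner p
      step <K =
        let p₀ , r₀≡ , c₀≡ = PA.position {i + a} {j} (inA (n≤1+n a)) in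
        ≤-trans (s≤s (layer-in-column a {i} {j} {p₀} (<⇒≤ a<K) (inA ∘ m≤n⇒m≤1+n) r₀≡ c₀≡))
          (column-layers {p₀} {p} (trans c₀≡ (sym c≡))
            (≤-trans (≤-reflexive (trans (cong suc r₀≡) (sym (+-suc i a)))) (≤-reflexive (sym r≡))) <K)

    -- The left column of the rectangle brings its bottom box to layer `K` or later; from there each
    -- step right along the bottom row raises the layer.
    layer-in-row : ∀ b {i j p} → (∀ {a′} → a′ ≤ K → ∀ {b′} → b′ ≤ b → Box A (i + a′) (j + b′)) →
                   row A p ≡ i + K → col A p ≡ j + b → K + b ≤ layerOfPartner p
    layer-in-row zero {i} {j} {p} inA r≡ c≡ = subst (_≤ layerOfPartner p) (sym (+-identityʳ K))
      (layer-in-column K {i} {j + 0} {p} ≤-refl (λ a≤ → inA a≤ z≤n) r≡ c≡)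
    layer-in-row (suc b) {i} {j} {p} inA r≡ c≡ =
      let p₀ , r₀≡ , c₀≡ = PA.position {i + K} {j + b} (inA ≤-refl (n≤1+n b))
          ih = layer-in-row b {i} {j} {p₀} (λ a≤ b≤ → inA a≤ (m≤n⇒m≤1+n b≤)) r₀≡ c₀≡
      in ≤-trans (≤-reflexive (+-suc K b)) (≤-trans (s≤s ih)
           (row-layers {p₀} {p} (trans r₀≡ (sym r≡))
             (≤-trans (≤-reflexive (trans (cong suc c₀≡) (sym (+-suc j b)))) (≤-reflexive (sym c≡)))
             (m+n≤o⇒m≤o K ih)))

  SameCorner : ℕ → ℕ × ℕ → ℕ × ℕ → Set
  SameCorner L (i , j) (i′ , j′) = ∃₂ λ p q →
    (row A p ≡ i + K × col A p ≡ j + L) × (row B q ≡ i′ + K × col B q ≡ j′ + L) × entry B U q ≡ entry A T p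

  sameCorner-injective : ∀ {L x x′ y} → SameCorner L x y → SameCorner L x′ y → x ≡ x′
  sameCorner-injective {L} {i , j} {i′ , j′} (p , q , (r≡ , c≡) , (rq≡ , cq≡) , eq)
                       (p′ , q′ , (r≡′ , c≡′) , (rq≡′ , cq≡′) , eq′) =
    cong₂ _,_ (+-cancelʳ-≡ K i i′ (trans (sym r≡) (trans (cong (row A) p≡p′) r≡′)))
              (+-cancelʳ-≡ L j j′ (trans (sym c≡) (trans (cong (col A) p≡p′) c≡′)))
    where
    q≡q′ : q ≡ q′
    q≡q′ = PB.position-injective q q′ (trans rq≡ (sym rq≡′)) (trans cq≡ (sym cq≡′))
    p≡p′ : p ≡ p′
    p≡p′ = injective p p′ (trans (sym eq) (trans (cong (entry B U) q≡q′) eq′))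

  corner-transfer : ∀ L {i j} → Rect (Box A) (suc K) (suc L) i j →
                    ∃₂ λ i′ j′ → Rect (Box B) (suc K) (suc L) i′ j′ × SameCorner L (i , j) (i′ , j′)
  corner-transfer L {i} {j} r =
    let p , r≡ , c≡ = PA.position {i + K} {j + L} (r ≤-refl ≤-refl)
        q , e≡ = partner p
        K≤ , lo≤ = vertical-corner {L = L} (layerAt q) (layer-in-row L {i} {j} {p} (λ a≤ b≤ → r (s≤s a≤) (s≤s b≤)) r≡ c≡)
        L≤ = m+n≤o⇒n≤o (part (SkewShape.innerParts B) (row B q ∸ K)) {L} lo≤
        j≡ = m∸n+n≡m L≤
        i≡ = m∸n+n≡m K≤
    -- The new top left box is found by going back from the partner of the corner; both subtractions
    -- are exact by `K≤` and `L≤`.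
    in row B q ∸ K , col B q ∸ L ,
       Rect⁺ (rowDiagram B) (m+n≤o⇒m≤o∸n (part (SkewShape.innerParts B) (row B q ∸ K)) lo≤)
         (subst₂ (λ j i → j < part (SkewShape.outerParts B) i) (sym j≡) (sym i≡) (proj₂ (PB.isBox q))) ,
       p , q , (r≡ , c≡) , (sym i≡ , sym j≡) , e≡

  rects-≤ : ∀ L → rects (suc K) (suc L) A ≤ rects (suc K) (suc L) B
  rects-≤ L = length-≤-via {ys = rectsOf (box? B) hB wB (suc K) (suc L)} (SameCorner L)
    (rectsOf-unique (box? A) hA wA (suc K) (suc L))
    (λ x∈ →
      let _ , _ , r = ∈rectsOf⁻ (box? A) hA wA (suc K) (suc L) x∈
          i′ , j′ , r′ , same = corner-transfer L r
          b′ = subst₂ (Box B) (+-identityʳ i′) (+-identityʳ j′) (r′ z<s z<s)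
      in (i′ , j′) , ∈rectsOf⁺ (box? B) hB wB (suc K) (suc L) (PB.box<height b′) (PB.box<width b′) r′ , same)
    (sameCorner-injective {L})
    where
    open SkewShape A renaming (height to hA; width to wA) using ()
    open SkewShape B renaming (height to hB; width to wB) using ()

-- The implication and the three equivalent conditions

FPositive⇒rects-≤ : ∀ A B → FPositive (s A ⊖ s B) → ∀ K L → rects (suc K) (suc L) A ≤ rects (suc K) (suc L) B
FPositive⇒rects-≤ A B pos K L =
  -- The tableau depends on the height of the rectangles only; it serves all widths.
  let T , syt , eq = FPositive⇒support A B pos (Layered.U B K) (Layered.U-SYT B K)
  in Transfer.rects-≤ A B K T syt eq L

module _ (A B : SkewShape) where

  private
    cond₁ = ∀ k → 1 ≤ k → rows k A ≼ rows k B
    cond₂ = ∀ ℓ → 1 ≤ ℓ → cols ℓ A ≼ cols ℓ B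
    cond₃ = ∀ k ℓ → 1 ≤ k → 1 ≤ ℓ → rects k ℓ A ≤ rects k ℓ B

  rows⇔rects : cond₁ ⇔ cond₃
  rows⇔rects = mk⇔
    (λ rows≼ → λ { (suc K) (suc L) _ _ → subst₂ _≤_ (sym (rects≡excess-rows A K L)) (sym (rects≡excess-rows B K L))
      (≼⇒excess-≤ (rows-decreasing A (suc K)) (rows≼ (suc K) z<s) L) })
    (λ rects≤ → λ { (suc K) _ → excess-≤⇒≼ (rows-decreasing B (suc K)) λ L →
      subst₂ _≤_ (rects≡excess-rows A K L) (rects≡excess-rows B K L) (rects≤ (suc K) (suc L) z<s z<s) })

  cols⇔rects : cond₂ ⇔ cond₃
  cols⇔rects = mk⇔
    -- For columns the width selects the overlap partition and the height gives the threshold.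
    (λ cols≼ → λ { (suc K) (suc L) _ _ → subst₂ _≤_ (sym (rects≡excess-cols A K L)) (sym (rects≡excess-cols B K L))
      (≼⇒excess-≤ (cols-decreasing A (suc L)) (cols≼ (suc L) z<s) K) })
    (λ rects≤ → λ { (suc L) _ → excess-≤⇒≼ (cols-decreasing B (suc L)) λ K →
      subst₂ _≤_ (rects≡excess-cols A K L) (rects≡excess-cols B K L) (rects≤ (suc K) (suc L) z<s z<s) })

  FPositive⇒rects : FPositive (s A ⊖ s B) → cond₃
  FPositive⇒rects pos (suc K) (suc L) _ _ = FPositive⇒rects-≤ A B pos K L

corollary4p2 : (A B : SkewShape) →
    let cond₁ = ∀ k → 1 ≤ k → rows k A ≼ rows k B
        cond₂ = ∀ ℓ → 1 ≤ ℓ → cols ℓ A ≼ cols ℓ B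
        cond₃ = ∀ k ℓ → 1 ≤ k → 1 ≤ ℓ → rects k ℓ A ≤ rects k ℓ B
    in (cond₁ ⇔ cond₂) × (cond₂ ⇔ cond₃) × (FPositive (s A ⊖ s B) → cond₁ × cond₂ × cond₃)
corollary4p2 A B =
  ⇔-sym (cols⇔rects A B) ⇔-∘ rows⇔rects A B ,
  cols⇔rects A B ,
  λ pos → let rects≤ = FPositive⇒rects A B pos in
    Equivalence.from (rows⇔rects A B) rects≤ , Equivalence.from (cols⇔rects A B) rects≤ , rects≤
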